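{- For all integers $L\geq 1$ and $n\geq 0$, $$ \sum_{m\geq 0}\binom{m}{2}a_2(L,m,n)\ \geq\ \sum_{m\geq 0}\binom{m}{2}b_2(L,m,n). $$
   Context: The hook length of a cell in the Young diagram of a partition is one plus the number of cells to its right in the same row plus the number of cells below it in the same column. A hook of length two means a cell whose hook length equals $2$. For integers $L\ge 1$ and $m,n\ge 0$: $a_2(L,m,n)$ is the number of partitions of $n$ into odd parts (repetitions allowed), each at most $2L-1$, having exactly $m$ hooks of length two; $b_2(L,m,n)$ is the number of partitions of $n$ into distinct parts, each at most $L$, having exactly $m$ hooks of length two. -}

module Defs where

open import Data.List.Base using (List; []; _∷_; _++_; length; map; filter; upTo; concatMap)
open import Data.List.Membership.Propositional using (_∈_)
open import Data.List.Membership.Propositional.Properties using (∈-filter⁺; ∈-filter⁻; ∈-concatMap⁺)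
open import Data.List.Properties using (length-filter; filter-none; length-++; length-map; length-upTo)
open import Data.List.Relation.Binary.Disjoint.Propositional using (Disjoint)
open import Data.List.Relation.Unary.All as All using (All; []; _∷_)
open import Data.List.Relation.Unary.AllPairs using ([]; _∷_)
open import Data.List.Relation.Unary.Any as Any using (here; there)
open import Data.List.Relation.Unary.Linked using (Linked; linked?)
open import Data.List.Relation.Unary.Unique.Propositional using (Unique)
open import Data.List.Relation.Unary.Unique.Propositional.Properties as Unique using (++⁺)
open import Data.Nat.Base using (ℕ; zero; suc; _+_; _*_; _∸_; _≤_; _<_; _≥_; z≤n; s≤s)
open import Data.Nat.Divisibility using (_∣_; _∣?_)
open import Data.Nat.ListAction using (sum)
open import Data.Nat.Properties using (_≟_; _≤?_; _<?_; _≥?_; suc-injective; <⇒≱)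
open import Data.List.Relation.Unary.Unique.DecPropositional _≟_ using (unique?)
open import Data.Product.Base using (_×_; _,_; proj₁; proj₂; map₁)
open import Function.Bundles using (_⇔_; mk⇔)
open import Relation.Binary.PropositionalEquality using (_≡_; _≢_; refl; sym; trans; cong; cong₂; subst)
open import Relation.Nullary.Decidable using (¬?; _×-dec_; map′)
open import Relation.Nullary.Negation using (¬_)
open import Relation.Unary using (Decidable)

record IsPartition (n : ℕ) (parts : List ℕ) : Set where
  constructor isPartition
  field
    nonincreasing : Linked _≥_ parts
    positive      : All (0 <_) parts
    size          : sum parts ≡ n

open IsPartition public

isPartition? : ∀ n → Decidable (IsPartition n)
isPartition? n xs =
  map′ (λ (d , p , s) → isPartition d p s) (λ q → nonincreasing q , positive q , size q)
       (linked? _≥?_ xs ×-dec All.all? (0 <?_) xs ×-dec (sum xs ≟ n))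

-- Each composition of suc n arises from exactly one composition of n, either
-- by prepending a part 1 or by increasing the first part.
extend : List ℕ → List (List ℕ)
extend []       = (1 ∷ []) ∷ []
extend (x ∷ xs) = (1 ∷ x ∷ xs) ∷ (suc x ∷ xs) ∷ []

compositions : ℕ → List (List ℕ)
compositions zero    = [] ∷ []
compositions (suc n) = concatMap extend (compositions n)

-- By ∈-partitions and partitions-unique below, every partition of n occurs in
-- this list exactly once, so lengths of its filtered sublists count partitions.
partitions : ℕ → List (List ℕ)
partitions n = filter (isPartition? n) (compositions n)

-- A cell is a pair (row , column), both counted from 0.
Cell : Set
Cell = ℕ × ℕ

cells : List ℕ → List Cell
cells []       = []
cells (x ∷ xs) = map (0 ,_) (upTo x) ++ map (map₁ suc) (cells xs)

RightOf : Cell → Cell → Set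
RightOf (i , j) (i′ , j′) = i′ ≡ i × j < j′

Below : Cell → Cell → Set
Below (i , j) (i′ , j′) = i < i′ × j′ ≡ j

rightOf? : ∀ c → Decidable (RightOf c)
rightOf? (i , j) (i′ , j′) = (i′ ≟ i) ×-dec (j <? j′)

below? : ∀ c → Decidable (Below c)
below? (i , j) (i′ , j′) = (i <? i′) ×-dec (j′ ≟ j)

hookLength : List ℕ → Cell → ℕ
hookLength xs c =
  1 + length (filter (rightOf? c) (cells xs)) + length (filter (below? c) (cells xs))

hooksOfLength : ℕ → List ℕ → ℕ
hooksOfLength k xs = length (filter (λ c → hookLength xs c ≟ k) (cells xs))

Odd : ℕ → Set
Odd x = ¬ (2 ∣ x)

odd? : Decidable Odd
odd? x = ¬? (2 ∣? x)

OddCondition : ℕ → ℕ → List ℕ → Set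
OddCondition L m xs = All Odd xs × All (_≤ 2 * L ∸ 1) xs × hooksOfLength 2 xs ≡ m

oddCondition? : ∀ L m → Decidable (OddCondition L m)
oddCondition? L m xs =
  All.all? odd? xs ×-dec All.all? (_≤? 2 * L ∸ 1) xs ×-dec (hooksOfLength 2 xs ≟ m)

DistinctCondition : ℕ → ℕ → List ℕ → Set
DistinctCondition L m xs = Unique xs × All (_≤ L) xs × hooksOfLength 2 xs ≡ m

distinctCondition? : ∀ L m → Decidable (DistinctCondition L m)
distinctCondition? L m xs =
  unique? xs ×-dec All.all? (_≤? L) xs ×-dec (hooksOfLength 2 xs ≟ m)

a₂ : ℕ → ℕ → ℕ → ℕ
a₂ L m n = length (filter (oddCondition? L m) (partitions n))

b₂ : ℕ → ℕ → ℕ → ℕ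
b₂ L m n = length (filter (distinctCondition? L m) (partitions n))

-- The sum of f m over 0 ≤ m ≤ n.  It equals the sum over all m ≥ 0 when f
-- vanishes beyond n, as a₂ L _ n and b₂ L _ n do (a₂-support, b₂-support).
∑≤ : ℕ → (ℕ → ℕ) → ℕ
∑≤ n f = sum (map f (upTo (suc n)))

infix 5 ∑≤
syntax ∑≤ n (λ m → e) = ∑[ m ≤ n ] e

private
  ∈-compositions : ∀ n xs → All (0 <_) xs → sum xs ≡ n → xs ∈ compositions n
  ∈-compositions zero    []                 _       _  = here refl
  ∈-compositions zero    (suc x ∷ xs)       _       ()
  ∈-compositions zero    (zero ∷ xs)        (() ∷ _) _
  ∈-compositions (suc n) []                 _       ()
  ∈-compositions (suc n) (zero ∷ xs)        (() ∷ _) _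
  ∈-compositions (suc n) (suc zero ∷ [])    _       eq =
    ∈-concatMap⁺ extend (Any.map (λ { refl → here refl }) (∈-compositions n [] [] (suc-injective eq)))
  ∈-compositions (suc n) (suc zero ∷ y ∷ ys) (_ ∷ p) eq =
    ∈-concatMap⁺ extend (Any.map (λ { refl → here refl }) (∈-compositions n (y ∷ ys) p (suc-injective eq)))
  ∈-compositions (suc n) (suc (suc x) ∷ xs) (_ ∷ p) eq =
    ∈-concatMap⁺ extend (Any.map (λ { refl → there (here refl) })
      (∈-compositions n (suc x ∷ xs) (s≤s z≤n ∷ p) (suc-injective eq)))

∈-partitions : ∀ n xs → xs ∈ partitions n ⇔ IsPartition n xs
∈-partitions n xs = mk⇔
  (λ xs∈ → proj₂ (∈-filter⁻ (isPartition? n) {xs = compositions n} xs∈))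
  (λ p → ∈-filter⁺ (isPartition? n) (∈-compositions n xs (positive p) (size p)) p)

private
  retract : List ℕ → List ℕ
  retract (suc zero ∷ xs)    = xs
  retract (suc (suc x) ∷ xs) = suc x ∷ xs
  retract xs                 = xs

  retract-extend : ∀ xs → All (0 <_) xs → All (λ ys → retract ys ≡ xs) (extend xs)
  retract-extend []           _        = refl ∷ []
  retract-extend (zero ∷ xs)  (() ∷ _)
  retract-extend (suc x ∷ xs) _        = refl ∷ refl ∷ []

  extend-positive : ∀ xs → All (0 <_) xs → All (All (0 <_)) (extend xs)
  extend-positive []       _       = (s≤s z≤n ∷ []) ∷ []
  extend-positive (x ∷ xs) (p ∷ q) = (s≤s z≤n ∷ p ∷ q) ∷ (s≤s z≤n ∷ q) ∷ []

  extend-unique : ∀ xs → All (0 <_) xs → Unique (extend xs)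
  extend-unique []           _        = [] ∷ []
  extend-unique (zero ∷ xs)  (() ∷ _)
  extend-unique (suc x ∷ xs) _        = ((λ ()) ∷ []) ∷ [] ∷ []

  All-++ : ∀ {P : List ℕ → Set} {xss yss} → All P xss → All P yss → All P (xss ++ yss)
  All-++ []       qs = qs
  All-++ (p ∷ ps) qs = p ∷ All-++ ps qs

  concatMap-positive : ∀ xss → All (All (0 <_)) xss → All (All (0 <_)) (concatMap extend xss)
  concatMap-positive []         []       = []
  concatMap-positive (xs ∷ xss) (p ∷ ps) = All-++ (extend-positive xs p) (concatMap-positive xss ps)

  retract-avoids : ∀ {xs} xss → All (All (0 <_)) xss → All (xs ≢_) xss →
                   All (λ ys → retract ys ≢ xs) (concatMap extend xss)
  retract-avoids []         []       []       = []
  retract-avoids (ys ∷ yss) (p ∷ ps) (q ∷ qs) =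
    All-++ (All.map (λ e e′ → q (trans (sym e′) e)) (retract-extend ys p)) (retract-avoids yss ps qs)

  concatMap-unique : ∀ xss → All (All (0 <_)) xss → Unique xss → Unique (concatMap extend xss)
  concatMap-unique []         []       []       = []
  concatMap-unique (xs ∷ xss) (p ∷ ps) (u ∷ us) =
    ++⁺ (extend-unique xs p) (concatMap-unique xss ps us) disjoint
    where
    disjoint : Disjoint (extend xs) (concatMap extend xss)
    disjoint (v∈ , v∈′) =
      All.lookup (retract-avoids xss ps u) v∈′ (All.lookup (retract-extend xs p) v∈)

  compositions-positive : ∀ n → All (All (0 <_)) (compositions n)
  compositions-positive zero    = [] ∷ []
  compositions-positive (suc n) = concatMap-positive (compositions n) (compositions-positive n)

  compositions-unique : ∀ n → Unique (compositions n)
  compositions-unique zero    = [] ∷ []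
  compositions-unique (suc n) =
    concatMap-unique (compositions n) (compositions-positive n) (compositions-unique n)

partitions-unique : ∀ n → Unique (partitions n)
partitions-unique n = Unique.filter⁺ (isPartition? n) (compositions-unique n)

length-cells : ∀ xs → length (cells xs) ≡ sum xs
length-cells []       = refl
length-cells (x ∷ xs) =
  trans (length-++ row)
        (cong₂ _+_ (trans (length-map first (upTo x)) (length-upTo x))
                   (trans (length-map (map₁ suc) (cells xs)) (length-cells xs)))
  where
  first : ℕ → Cell
  first = 0 ,_

  row : List Cell
  row = map first (upTo x)

hooksOfLength-≤ : ∀ k xs → hooksOfLength k xs ≤ sum xs
hooksOfLength-≤ k xs =
  subst (hooksOfLength k xs ≤_) (length-cells xs)
        (length-filter (λ c → hookLength xs c ≟ k) (cells xs))

private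
  too-many-hooks : ∀ {n m xs} → n < m → xs ∈ partitions n → hooksOfLength 2 xs ≢ m
  too-many-hooks {n} {m} {xs} n<m xs∈ refl =
    <⇒≱ n<m (subst (hooksOfLength 2 xs ≤_)
                   (size (proj₂ (∈-filter⁻ (isPartition? n) {xs = compositions n} xs∈)))
                   (hooksOfLength-≤ 2 xs))

a₂-support : ∀ L m n → n < m → a₂ L m n ≡ 0
a₂-support L m n n<m = cong length (filter-none (oddCondition? L m)
  (All.tabulate λ xs∈ (_ , _ , h) → too-many-hooks n<m xs∈ h))

b₂-support : ∀ L m n → n < m → b₂ L m n ≡ 0
b₂-support L m n n<m = cong length (filter-none (distinctCondition? L m)
  (All.tabulate λ xs∈ (_ , _ , h) → too-many-hooks n<m xs∈ h))

{-# OPTIONS --safe #-}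

-- Let h be the number of hooks of length two.  Put D(L) = ∏ (1 + qⁱ) and O(L) = ∏ 1 / (1 − q²ⁱ⁻¹),
-- where 1 ≤ i ≤ L, and let eₖ(N) be the k-th elementary symmetric polynomial in q², q⁴, …, q²ᴺ.
--
-- For distinct parts, h increases exactly when the new largest part leaves a gap of at least two,
-- so the generating functions Fₖ(L) of the moments ∑ C(h, k) satisfy
--   Fₖ₊₁(L + 2) = (1 + qᴸ⁺²) Fₖ₊₁(L + 1) + qᴸ⁺² Fₖ(L),
-- which is solved by Fₖ(L + 2k) = D(L) eₖ(L + k).  For odd parts, adding the part size 2L + 1 ≥ 3
-- once creates a gap, so the moments Hₖ satisfy
--   Hₖ₊₁(L + 1) ≥ Hₖ₊₁(L) + q²ᴸ⁺¹ (Hₖ(L) + Hₖ₊₁(L + 1)),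
-- whence Hₖ(L) ≥ O(L) eₖ(L); the missing factor q is supplied by q O(L) ≤ O(L).  Finally D(L) ≤ O(L)
-- because D(L) ∏ 1 / (1 − qᴸ⁺ⁱ) = O(L).

module Submission where

open import Defs
open import Algebra.Bundles using (CommutativeSemiring)
import Algebra.Construct.Pointwise as Pointwise
open import Algebra.Properties.CommutativeSemigroup using (interchange)
open import Algebra.Structures.Biased using (isCommutativeSemiringˡ; isCommutativeMonoidˡ)
open import Data.Bool.Base using (true; false)
open import Data.List.Base using (List; []; _∷_; _++_; _∷ʳ_; length; map; filter; upTo)
open import Data.List.Membership.Propositional using (_∈_)
open import Data.List.Membership.Propositional.Properties
  using (∈-∃++; ∈-filter⁺; ∈-filter⁻; ∈-map⁺; ∈-map⁻; ∈-++⁺ˡ; ∈-++⁺ʳ; ∈-++⁻)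
open import Data.List.Properties
  using ( ++-assoc; length-++; map-++; map-∘; map-cong; upTo-∷ʳ; ∷-injectiveʳ
        ; filter-++; filter-none; filter-some; filter-≐; filter-accept; filter-reject)
open import Data.List.Relation.Binary.Disjoint.Propositional using (Disjoint)
import Data.List.Relation.Binary.Permutation.Propositional.Properties as ↭
open import Data.List.Relation.Binary.Subset.Propositional using (_⊆_)
open import Data.List.Relation.Unary.All as All using (All; []; _∷_)
import Data.List.Relation.Unary.All.Properties as All
open import Data.List.Relation.Unary.AllPairs as AllPairs using ([]; _∷_)
open import Data.List.Relation.Unary.Any using (Any; here; there)
import Data.List.Relation.Unary.Any.Properties as Any
open import Data.List.Relation.Unary.Linked as Linked using (Linked; []; [-]; _∷_)
open import Data.List.Relation.Unary.Linked.Properties using (Linked⇒AllPairs)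
open import Data.List.Relation.Unary.Unique.Propositional using (Unique)
import Data.List.Relation.Unary.Unique.Propositional.Properties as Unique
open import Data.Nat.Base
  using (ℕ; zero; suc; _+_; _*_; _∸_; _≤_; _<_; _≥_; z≤n; s≤s; s<s⁻¹; _≤′_; ≤′-refl; ≤′-step)
open import Data.Nat.Combinatorics using (_C_; nCk+nC[k+1]≡[n+1]C[k+1])
open import Data.Nat.Divisibility using (_∣_; _∣0; ∣m+n∣m⇒∣n; m∣m*n; ∣1⇒≡1)
open import Data.Nat.Induction using (<-rec)
open import Data.Nat.ListAction using (sum)
open import Data.Nat.ListAction.Properties using (sum-++; sum-↭)
open import Data.Nat.Properties
open import Data.List.Relation.Unary.Unique.DecPropositional _≟_ using (unique?)
open import Data.Nat.Solver using (module +-*-Solver)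
open import Data.Product.Base using (∃; _×_; _,_; proj₁; proj₂; map₁)
open import Data.Sum.Base using (_⊎_; inj₁; inj₂)
open import Function.Base using (_∘_; id)
open import Function.Bundles using (_⇔_; mk⇔; Equivalence)
open import Level using (0ℓ)
open import Relation.Binary.Bundles using (Preorder)
open import Relation.Binary.PropositionalEquality
open import Relation.Nullary.Decidable using (does; yes; no; _×-dec_)
open import Relation.Nullary.Negation using (¬_; contradiction)
open import Relation.Unary using (Decidable; Pred)

-- Formal power series over ℕ

Series : Set
Series = ℕ → ℕ

infixl 6 _⊕_
infixl 7 _⊛_
infix 4 _≼_

_⊕_ : Series → Series → Series
(f ⊕ g) n = f n + g n

-- The Cauchy product, by recursion on the index: the constant coefficient of the left factor is
-- split off and the left factor is shifted down.
_⊛_ : Series → Series → Series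
(f ⊛ g) zero    = f 0 * g 0
(f ⊛ g) (suc n) = f 0 * g (suc n) + (f ∘ suc ⊛ g) n

𝟘 𝟙 q : Series
𝟘 n       = 0
𝟙 zero    = 1
𝟙 (suc n) = 0
q zero    = 0
q (suc n) = 𝟙 n

_≼_ : Series → Series → Set
f ≼ g = ∀ n → f n ≤ g n

⊛-cong : ∀ {f f′ g g′} → f ≗ f′ → g ≗ g′ → f ⊛ g ≗ f′ ⊛ g′
⊛-cong f≗ g≗ zero    = cong₂ _*_ (f≗ 0) (g≗ 0)
⊛-cong f≗ g≗ (suc n) = cong₂ _+_ (cong₂ _*_ (f≗ 0) (g≗ (suc n))) (⊛-cong (f≗ ∘ suc) g≗ n)

⊛-distribʳ-⊕ : ∀ h f g → (f ⊕ g) ⊛ h ≗ (f ⊛ h) ⊕ (g ⊛ h)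
⊛-distribʳ-⊕ h f g zero    = *-distribʳ-+ (h 0) (f 0) (g 0)
⊛-distribʳ-⊕ h f g (suc n) rewrite ⊛-distribʳ-⊕ h (f ∘ suc) (g ∘ suc) n =
  solve 5 (λ a b c x y → (a :+ b) :* c :+ (x :+ y) := (a :* c :+ x) :+ (b :* c :+ y))
    refl (f 0) (g 0) (h (suc n)) _ _
  where open +-*-Solver

⊛-scale : ∀ a f g → (λ n → a * f n) ⊛ g ≗ λ n → a * (f ⊛ g) n
⊛-scale a f g zero    = *-assoc a (f 0) (g 0)
⊛-scale a f g (suc n) rewrite ⊛-scale a (f ∘ suc) g n =
  solve 4 (λ a b c x → (a :* b) :* c :+ a :* x := a :* (b :* c :+ x))
    refl a (f 0) (g (suc n)) _
  where open +-*-Solver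

⊛-assoc : ∀ f g h → (f ⊛ g) ⊛ h ≗ f ⊛ (g ⊛ h)
⊛-assoc f g h zero    = *-assoc (f 0) (g 0) (h 0)
⊛-assoc f g h (suc n)
  rewrite ⊛-distribʳ-⊕ h (λ m → f 0 * g (suc m)) (f ∘ suc ⊛ g) n
        | ⊛-scale (f 0) (g ∘ suc) h n | ⊛-assoc (f ∘ suc) g h n =
  solve 5 (λ a b c x y → (a :* b) :* c :+ (a :* x :+ y) := a :* (b :* c :+ x) :+ y)
    refl (f 0) (g 0) (h (suc n)) _ _
  where open +-*-Solver

-- Mirror image of the defining equation, peeling the right factor instead of the left one;
-- commutativity follows by comparing the two.
⊛-sucʳ : ∀ f g n → (f ⊛ g) (suc n) ≡ (f ⊛ (g ∘ suc)) n + f (suc n) * g 0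
⊛-sucʳ f g zero    = refl
⊛-sucʳ f g (suc n) rewrite ⊛-sucʳ (f ∘ suc) g n = sym (+-assoc (f 0 * g (2 + n)) _ _)

⊛-comm : ∀ f g → f ⊛ g ≗ g ⊛ f
⊛-comm f g zero    = *-comm (f 0) (g 0)
⊛-comm f g (suc n) rewrite ⊛-sucʳ g f n | ⊛-comm (f ∘ suc) g n | *-comm (f 0) (g (suc n)) =
  +-comm (g (suc n) * f 0) _

⊛-zeroˡ : ∀ f → 𝟘 ⊛ f ≗ 𝟘
⊛-zeroˡ f zero    = refl
⊛-zeroˡ f (suc n) = ⊛-zeroˡ f n

⊛-identityˡ : ∀ f → 𝟙 ⊛ f ≗ f
⊛-identityˡ f zero    = +-identityʳ (f 0)
⊛-identityˡ f (suc n) rewrite ⊛-zeroˡ f n | +-identityʳ (f (suc n)) = +-identityʳ (f (suc n))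

-- Gives access to the ring solver and to powers. There is no subtraction, so all identities below
-- are kept subtraction-free.
seriesSemiring : CommutativeSemiring 0ℓ 0ℓ
seriesSemiring = record
  { Carrier = Series
  ; _≈_ = _≗_
  ; _+_ = _⊕_
  ; _*_ = _⊛_
  ; 0# = 𝟘
  ; 1# = 𝟙
  ; isCommutativeSemiring = isCommutativeSemiringˡ record
    { +-isCommutativeMonoid = Pointwise.isCommutativeMonoid ℕ +-0-isCommutativeMonoid
    ; *-isCommutativeMonoid = isCommutativeMonoidˡ record
      { isSemigroup = record
        { isMagma = record
          { isEquivalence = Pointwise.isEquivalence ℕ isEquivalence
          ; ∙-cong = ⊛-cong
          }
        ; assoc = ⊛-assoc
        }
      ; identityˡ = ⊛-identityˡ
      ; comm = ⊛-comm
      }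
    ; distribʳ = ⊛-distribʳ-⊕
    ; zeroˡ = ⊛-zeroˡ
    }
  }

≼-preorder : Preorder 0ℓ 0ℓ 0ℓ
≼-preorder = record
  { Carrier = Series
  ; _≈_ = _≗_
  ; _≲_ = _≼_
  ; isPreorder = record
    { isEquivalence = Pointwise.isEquivalence ℕ isEquivalence
    ; reflexive = λ f≗g n → ≤-reflexive (f≗g n)
    ; trans = λ f≼g g≼h n → ≤-trans (f≼g n) (g≼h n)
    }
  }

≼-refl : ∀ {f} → f ≼ f
≼-refl n = ≤-refl

⊕-mono-≼ : ∀ {f f′ g g′} → f ≼ f′ → g ≼ g′ → f ⊕ g ≼ f′ ⊕ g′
⊕-mono-≼ f≼ g≼ n = +-mono-≤ (f≼ n) (g≼ n)

⊛-mono-≼ : ∀ {f f′ g g′} → f ≼ f′ → g ≼ g′ → f ⊛ g ≼ f′ ⊛ g′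
⊛-mono-≼ f≼ g≼ zero    = *-mono-≤ (f≼ 0) (g≼ 0)
⊛-mono-≼ f≼ g≼ (suc n) = +-mono-≤ (*-mono-≤ (f≼ 0) (g≼ (suc n))) (⊛-mono-≼ (f≼ ∘ suc) g≼ n)

-- Coefficient `n` of a product sees only the coefficients of its factors up to `n`; this local form
-- makes strong induction on the index possible.
⊛-mono-upTo : ∀ h {f g} n → (∀ m → m ≤ n → f m ≤ g m) → (h ⊛ f) n ≤ (h ⊛ g) n
⊛-mono-upTo h zero    f≤g = *-monoʳ-≤ (h 0) (f≤g 0 z≤n)
⊛-mono-upTo h (suc n) f≤g =
  +-mono-≤ (*-monoʳ-≤ (h 0) (f≤g (suc n) ≤-refl))
             (⊛-mono-upTo (h ∘ suc) n (λ m m≤n → f≤g m (m≤n⇒m≤1+n m≤n)))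

open CommutativeSemiring seriesSemiring using (semiring)
  renaming ( setoid to ≗-setoid; refl to ≗-refl; sym to ≗-sym; +-cong to ⊕-cong
           ; +-congˡ to ⊕-congˡ; +-congʳ to ⊕-congʳ; *-congˡ to ⊛-congˡ; *-congʳ to ⊛-congʳ; *-identityʳ to ⊛-identityʳ)
open import Algebra.Properties.Semiring.Exp semiring using (_^_; ^-homo-*)
open import Algebra.Solver.Ring.NaturalCoefficients.Default seriesSemiring using (solve; _:=_; _:+_; _:*_; con)
module ≗-Reasoning where
  open import Relation.Binary.Reasoning.Setoid ≗-setoid public
module ≼-Reasoning where
  open import Relation.Binary.Reasoning.Preorder ≼-preorder public

-- Powers of `q`, fixpoint equations and geometric series

q⊛-suc : ∀ f n → (q ⊛ f) (suc n) ≡ f n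
q⊛-suc f n = ⊛-identityˡ f n

qs⊛ : ∀ s f → (q ^ suc s) ⊛ f ≗ q ⊛ ((q ^ s) ⊛ f)
qs⊛ s f = ⊛-assoc q (q ^ s) f

⊛-mono-below : ∀ t {f g} n → (∀ m → m < n → f m ≤ g m) → ((q ^ suc t) ⊛ f) n ≤ ((q ^ suc t) ⊛ g) n
⊛-mono-below t         zero    _   = z≤n
⊛-mono-below t {f} {g} (suc n) f≤g
  rewrite qs⊛ t f (suc n) | qs⊛ t g (suc n) | q⊛-suc ((q ^ t) ⊛ f) n | q⊛-suc ((q ^ t) ⊛ g) n =
  ⊛-mono-upTo (q ^ t) n (λ m m≤n → f≤g m (s≤s m≤n))

-- Subsolutions of X = a + qᵗ⁺¹ X lie below supersolutions: the factor qᵗ⁺¹ makes coefficient `n` of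
-- the right side depend only on earlier coefficients of X. This replaces division by 1 - qᵗ⁺¹.
fixpoint-≼ : ∀ t a {f g} → f ≼ a ⊕ (q ^ suc t) ⊛ f → a ⊕ (q ^ suc t) ⊛ g ≼ g → f ≼ g
fixpoint-≼ t a {f} {g} f≼ ≼g = <-rec _ λ n f≤g →
  ≤-trans (f≼ n) (≤-trans (+-monoʳ-≤ (a n) (⊛-mono-below t n (λ m m<n → f≤g m<n))) (≼g n))

-- The indicator series of the set of all i + (t + 1) j.
pulses : ℕ → ℕ → Series
pulses t zero    zero    = 1
pulses t (suc i) zero    = 0
pulses t zero    (suc n) = pulses t t n
pulses t (suc i) (suc n) = pulses t i n

-- 1 / (1 − qᵗ⁺¹)
geometric : ℕ → Series
geometric t = pulses t 0

pulses≗q^⊛geometric : ∀ t i → pulses t i ≗ (q ^ i) ⊛ geometric t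
pulses≗q^⊛geometric t zero    n       = sym (⊛-identityˡ (geometric t) n)
pulses≗q^⊛geometric t (suc i) zero    = refl
pulses≗q^⊛geometric t (suc i) (suc n) = begin
  pulses t i n                             ≡⟨ pulses≗q^⊛geometric t i n ⟩
  ((q ^ i) ⊛ geometric t) n                ≡⟨ q⊛-suc _ n ⟨
  (q ⊛ ((q ^ i) ⊛ geometric t)) (suc n)    ≡⟨ qs⊛ i (geometric t) (suc n) ⟨
  ((q ^ suc i) ⊛ geometric t) (suc n)      ∎
  where open ≡-Reasoning

geometric-unfold : ∀ t → geometric t ≗ 𝟙 ⊕ (q ^ suc t) ⊛ geometric t
geometric-unfold t zero    = refl
geometric-unfold t (suc n) = begin
  pulses t t n                             ≡⟨ pulses≗q^⊛geometric t t n ⟩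
  ((q ^ t) ⊛ geometric t) n                ≡⟨ q⊛-suc _ n ⟨
  (q ⊛ ((q ^ t) ⊛ geometric t)) (suc n)    ≡⟨ qs⊛ t (geometric t) (suc n) ⟨
  ((q ^ suc t) ⊛ geometric t) (suc n)      ∎
  where open ≡-Reasoning

geometric⊛-unfold : ∀ t a → geometric t ⊛ a ≗ a ⊕ (q ^ suc t) ⊛ (geometric t ⊛ a)
geometric⊛-unfold t a = begin
  geometric t ⊛ a                             ≈⟨ ⊛-congʳ (geometric-unfold t) ⟩
  (𝟙 ⊕ (q ^ suc t) ⊛ geometric t) ⊛ a
    ≈⟨ solve 3 (λ x g a → (con 1 :+ x :* g) :* a := a :+ x :* (g :* a)) ≗-refl (q ^ suc t) (geometric t) a ⟩
  a ⊕ (q ^ suc t) ⊛ (geometric t ⊛ a)         ∎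
  where open ≗-Reasoning

-- The product solves the fixpoint equation, hence lies below each supersolution. It turns recursive
-- lower bounds for odd parts into product formulas.
geometric⊛-≼ : ∀ t a {f} → a ⊕ (q ^ suc t) ⊛ f ≼ f → geometric t ⊛ a ≼ f
geometric⊛-≼ t a = fixpoint-≼ t a (λ n → ≤-reflexive (geometric⊛-unfold t a n))

-- Uniqueness of the solution, by comparing in both directions.
≗-geometric⊛ : ∀ t a {f} → f ≗ a ⊕ (q ^ suc t) ⊛ f → f ≗ geometric t ⊛ a
≗-geometric⊛ t a f≗ n = ≤-antisym
  (fixpoint-≼ t a (λ m → ≤-reflexive (f≗ m)) (λ m → ≤-reflexive (sym (geometric⊛-unfold t a m))) n)
  (geometric⊛-≼ t a (λ m → ≤-reflexive (sym (f≗ m))) n)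

-- The recurrence for distinct parts and its solution

distinctProduct : ℕ → Series
distinctProduct zero    = 𝟙
distinctProduct (suc L) = (𝟙 ⊕ q ^ suc L) ⊛ distinctProduct L

-- The k-th elementary symmetric polynomial in q², q⁴, …, q²ᴺ.
elementary : ℕ → ℕ → Series
elementary zero    N       = 𝟙
elementary (suc k) zero    = 𝟘
elementary (suc k) (suc N) = elementary (suc k) N ⊕ (q ⊛ q) ^ suc N ⊛ elementary k N

-- The two zero rows reflect that distinct parts of size at most 1 give no hook of length two.
distinctMoment : ℕ → ℕ → Series
distinctMoment zero    L             = distinctProduct L
distinctMoment (suc k) zero          = 𝟘
distinctMoment (suc k) (suc zero)    = 𝟘
distinctMoment (suc k) (suc (suc L)) =
  (𝟙 ⊕ q ^ (2 + L)) ⊛ distinctMoment (suc k) (suc L) ⊕ q ^ (2 + L) ⊛ distinctMoment k L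

-- Compare the coefficients of zᵏ⁺¹ on the two sides of
-- (1 + z p) ∏ᵢ (1 + z p pⁱ) = (1 + z pᴺ⁺¹) ∏ᵢ (1 + z pⁱ), where p = q² and 1 ≤ i ≤ N.
elementary-dilate : ∀ k N →
  (q ⊛ q) ^ suc k ⊛ (elementary (suc k) N ⊕ elementary k N) ≗
  elementary (suc k) N ⊕ (q ⊛ q) ^ suc N ⊛ elementary k N
elementary-dilate zero    zero    =
  solve 1 (λ p → p :* (con 0 :+ con 1) := con 0 :+ p :* con 1) ≗-refl ((q ⊛ q) ^ 1)
elementary-dilate (suc k) zero    =
  solve 2 (λ p p′ → p :* (con 0 :+ con 0) := con 0 :+ p′ :* con 0) ≗-refl ((q ⊛ q) ^ suc (suc k)) ((q ⊛ q) ^ 1)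
elementary-dilate zero    (suc N) = begin
  (p ⊛ 𝟙) ⊛ ((E ⊕ y ⊛ 𝟙) ⊕ 𝟙)
    ≈⟨ solve 3 (λ p E y → (p :* con 1) :* ((E :+ y :* con 1) :+ con 1) :=
                          (p :* con 1) :* (E :+ con 1) :+ (p :* y) :* con 1) ≗-refl p E y ⟩
  (p ⊛ 𝟙) ⊛ (E ⊕ 𝟙) ⊕ (p ⊛ y) ⊛ 𝟙
    ≈⟨ ⊕-congʳ {(p ⊛ y) ⊛ 𝟙} (elementary-dilate zero N) ⟩
  (E ⊕ y ⊛ 𝟙) ⊕ (p ⊛ y) ⊛ 𝟙 ∎
  where
  open ≗-Reasoning
  p = q ⊛ q
  y = p ^ suc N
  E = elementary 1 N
elementary-dilate (suc k) (suc N) = begin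
  (p ⊛ x) ⊛ ((E ⊕ y ⊛ F) ⊕ (F ⊕ y ⊛ G))
    -- The last variable `y` is separated, which leaves the left sides of the induction hypotheses
    -- of orders `suc k` and `k`.
    ≈⟨ solve 6 (λ p x y E F G → (p :* x) :* ((E :+ y :* F) :+ (F :+ y :* G)) :=
                          (p :* x) :* (E :+ F) :+ (p :* y) :* (x :* (F :+ G))) ≗-refl p x y E F G ⟩
  (p ⊛ x) ⊛ (E ⊕ F) ⊕ (p ⊛ y) ⊛ (x ⊛ (F ⊕ G))
    ≈⟨ ⊕-cong (elementary-dilate (suc k) N) (⊛-congˡ {p ⊛ y} (elementary-dilate k N)) ⟩
  (E ⊕ y ⊛ F) ⊕ (p ⊛ y) ⊛ (F ⊕ y ⊛ G) ∎
  where
  open ≗-Reasoning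
  p = q ⊛ q
  x = p ^ suc k
  y = p ^ suc N
  E = elementary (suc (suc k)) N
  F = elementary (suc k) N
  G = elementary k N

-- Fewer than `k` variables admit no product of `k` distinct ones.
elementary-zero : ∀ k N → N < k → elementary k N ≗ 𝟘
elementary-zero (suc k) zero    _   = ≗-refl
elementary-zero (suc k) (suc N) N<k = begin
  elementary (suc k) N ⊕ (q ⊛ q) ^ suc N ⊛ elementary k N
    ≈⟨ ⊕-cong (elementary-zero (suc k) N (<-trans (n<1+n N) N<k))
              (⊛-congˡ {(q ⊛ q) ^ suc N} (elementary-zero k N (s<s⁻¹ N<k))) ⟩
  𝟘 ⊕ (q ⊛ q) ^ suc N ⊛ 𝟘
    ≈⟨ solve 1 (λ y → con 0 :+ y :* con 0 := con 0) ≗-refl ((q ⊛ q) ^ suc N) ⟩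
  𝟘 ∎
  where open ≗-Reasoning

[x⊛x]^n≗x^n⊛x^n : ∀ x n → (x ⊛ x) ^ n ≗ x ^ n ⊛ x ^ n
[x⊛x]^n≗x^n⊛x^n x zero    = ≗-sym (⊛-identityˡ 𝟙)
[x⊛x]^n≗x^n⊛x^n x (suc n) = begin
  (x ⊛ x) ⊛ (x ⊛ x) ^ n       ≈⟨ ⊛-congˡ {x ⊛ x} ([x⊛x]^n≗x^n⊛x^n x n) ⟩
  (x ⊛ x) ⊛ (x ^ n ⊛ x ^ n)
    ≈⟨ solve 2 (λ x y → (x :* x) :* (y :* y) := (x :* y) :* (x :* y)) ≗-refl x (x ^ n) ⟩
  (x ⊛ x ^ n) ⊛ (x ⊛ x ^ n)   ∎
  where open ≗-Reasoning

[x⊛x]^n≗x^[n+n] : ∀ x n → (x ⊛ x) ^ n ≗ x ^ (n + n)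
[x⊛x]^n≗x^[n+n] x n m = trans ([x⊛x]^n≗x^n⊛x^n x n m) (sym (^-homo-* x n n m))

-- In the recurrence, lowering the order by one costs two in the bound, and every positive order
-- starts from zero at the bounds 0 and 1.
distinctMoment-zero : ∀ k L → L < k + k → distinctMoment k L ≗ 𝟘
distinctMoment-zero (suc k) zero          _   = ≗-refl
distinctMoment-zero (suc k) (suc zero)    _   = ≗-refl
distinctMoment-zero (suc k) (suc (suc L)) L<2k = begin
  (𝟙 ⊕ x) ⊛ distinctMoment (suc k) (suc L) ⊕ x ⊛ distinctMoment k L
    ≈⟨ ⊕-cong (⊛-congˡ {𝟙 ⊕ x} (distinctMoment-zero (suc k) (suc L) (<-trans (n<1+n _) L<2k)))
              (⊛-congˡ {x} (distinctMoment-zero k L (s<s⁻¹ (subst (suc L <_) (+-suc k k) (s<s⁻¹ L<2k))))) ⟩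
  (𝟙 ⊕ x) ⊛ 𝟘 ⊕ x ⊛ 𝟘
    ≈⟨ solve 1 (λ x → (con 1 :+ x) :* con 0 :+ x :* con 0 := con 0) ≗-refl x ⟩
  𝟘 ∎
  where
  open ≗-Reasoning
  x = q ^ (2 + L)

-- The defining recurrence at a bound of the form L + 2(k + 1), with its power of `q` factored so
-- that the `k`-dependent and the `L`-dependent factors can be handled separately.
distinctMoment-suc : ∀ k L →
  let y = (q ⊛ q) ^ suc k ⊛ q ^ L in
  distinctMoment (suc k) (suc k + (suc k + L)) ≗
  (𝟙 ⊕ y) ⊛ distinctMoment (suc k) (suc (k + (k + L))) ⊕ y ⊛ distinctMoment k (k + (k + L))
distinctMoment-suc k L = begin
  distinctMoment (suc k) (suc k + (suc k + L))
    ≡⟨ cong (λ m → distinctMoment (suc k) (suc m)) (+-suc k (k + L)) ⟩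
  (𝟙 ⊕ z) ⊛ m₁ ⊕ z ⊛ m₀
    ≈⟨ ⊕-cong (⊛-congʳ {m₁} (⊕-congˡ {𝟙} z≗y)) (⊛-congʳ {m₀} z≗y) ⟩
  (𝟙 ⊕ y) ⊛ m₁ ⊕ y ⊛ m₀ ∎
  where
  open ≗-Reasoning
  y  = (q ⊛ q) ^ suc k ⊛ q ^ L
  z  = q ^ (2 + (k + (k + L)))
  m₁ = distinctMoment (suc k) (suc (k + (k + L)))
  m₀ = distinctMoment k (k + (k + L))
  z≗y : z ≗ y
  z≗y = begin
    q ^ (2 + (k + (k + L)))          ≡⟨ cong (λ m → q ^ (2 + m)) (+-assoc k k L) ⟨
    q ^ (2 + (k + k + L))            ≡⟨ cong (λ m → q ^ (suc m + L)) (+-suc k k) ⟨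
    q ^ (suc k + suc k + L)          ≈⟨ ^-homo-* q (suc k + suc k) L ⟩
    q ^ (suc k + suc k) ⊛ q ^ L      ≈⟨ ⊛-congʳ {q ^ L} ([x⊛x]^n≗x^[n+n] q (suc k)) ⟨
    y                                ∎

-- Induction on `k` and `L`: the recurrence refers to the same order with `L` lowered by one and to
-- the preceding order with the same `L`.
distinctMoment-closed : ∀ k L →
  distinctMoment k (k + (k + L)) ≗ distinctProduct L ⊛ elementary k (k + L)
distinctMoment-closed zero    L       = ≗-sym (⊛-identityʳ (distinctProduct L))
distinctMoment-closed (suc k) zero    = begin
  distinctMoment (suc k) (suc k + (suc k + 0))
    ≈⟨ distinctMoment-suc k 0 ⟩
  (𝟙 ⊕ P ⊛ 𝟙) ⊛ distinctMoment (suc k) (suc (k + (k + 0))) ⊕ (P ⊛ 𝟙) ⊛ distinctMoment k (k + (k + 0))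
    -- The bound 2k + 1 is too small for order k + 1, so the first summand vanishes. On the other
    -- side, the elementary polynomial of order k + 1 in `k` variables vanishes as well.
    ≈⟨ ⊕-cong (⊛-congˡ {𝟙 ⊕ P ⊛ 𝟙} (distinctMoment-zero (suc k) _ bound))
              (⊛-congˡ {P ⊛ 𝟙} (distinctMoment-closed k 0)) ⟩
  (𝟙 ⊕ P ⊛ 𝟙) ⊛ 𝟘 ⊕ (P ⊛ 𝟙) ⊛ (𝟙 ⊛ F)
    ≈⟨ solve 2 (λ P F → (con 1 :+ P :* con 1) :* con 0 :+ (P :* con 1) :* (con 1 :* F) :=
                        con 1 :* (con 0 :+ P :* F)) ≗-refl P F ⟩
  𝟙 ⊛ (𝟘 ⊕ P ⊛ F)
    ≡⟨ cong (λ m → 𝟙 ⊛ (𝟘 ⊕ (q ⊛ q) ^ suc m ⊛ F)) (+-identityʳ k) ⟨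
  𝟙 ⊛ (𝟘 ⊕ (q ⊛ q) ^ suc (k + 0) ⊛ F)
    ≈⟨ ⊛-congˡ {𝟙} (⊕-congʳ {(q ⊛ q) ^ suc (k + 0) ⊛ F}
         (elementary-zero (suc k) (k + 0) (≤-reflexive (cong suc (+-identityʳ k))))) ⟨
  𝟙 ⊛ elementary (suc k) (suc k + 0) ∎
  where
  open ≗-Reasoning
  P = (q ⊛ q) ^ suc k
  F = elementary k (k + 0)
  bound : suc (k + (k + 0)) < suc k + suc k
  bound = ≤-reflexive (trans (cong (λ m → 2 + (k + m)) (+-identityʳ k)) (cong suc (sym (+-suc k k))))
distinctMoment-closed (suc k) (suc L) = begin
  distinctMoment (suc k) (suc k + (suc k + suc L))
    ≈⟨ distinctMoment-suc k (suc L) ⟩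
  (𝟙 ⊕ P ⊛ x) ⊛ distinctMoment (suc k) (suc (k + N)) ⊕ (P ⊛ x) ⊛ distinctMoment k (k + N)
    ≡⟨ cong (λ m → (𝟙 ⊕ P ⊛ x) ⊛ distinctMoment (suc k) (suc (k + m)) ⊕ (P ⊛ x) ⊛ distinctMoment k (k + N))
            (+-suc k L) ⟩
  (𝟙 ⊕ P ⊛ x) ⊛ distinctMoment (suc k) (suc k + (suc k + L)) ⊕ (P ⊛ x) ⊛ distinctMoment k (k + N)
    ≈⟨ ⊕-cong (⊛-congˡ {𝟙 ⊕ P ⊛ x} (distinctMoment-closed (suc k) L))
              (⊛-congˡ {P ⊛ x} (distinctMoment-closed k (suc L))) ⟩
  (𝟙 ⊕ P ⊛ x) ⊛ (D ⊛ elementary (suc k) (suc (k + L))) ⊕ (P ⊛ x) ⊛ (((𝟙 ⊕ x) ⊛ D) ⊛ F)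
    ≡⟨ cong (λ m → (𝟙 ⊕ P ⊛ x) ⊛ (D ⊛ elementary (suc k) m) ⊕ (P ⊛ x) ⊛ (((𝟙 ⊕ x) ⊛ D) ⊛ F)) (+-suc k L) ⟨
  (𝟙 ⊕ P ⊛ x) ⊛ (D ⊛ E) ⊕ (P ⊛ x) ⊛ (((𝟙 ⊕ x) ⊛ D) ⊛ F)
    -- Regrouped so that `P ⊛ (E ⊕ F)` is the left side of `elementary-dilate`, while `P ⊛ (x ⊛ x)`
    -- is the new variable `z`. Both groups then contain the factor `E ⊕ z ⊛ F`, and 1 + x can be
    -- extracted.
    ≈⟨ solve 5 (λ x P D E F →
         (con 1 :+ P :* x) :* (D :* E) :+ (P :* x) :* (((con 1 :+ x) :* D) :* F) :=
         D :* (E :+ (P :* (x :* x)) :* F) :+ (x :* D) :* (P :* (E :+ F))) ≗-refl x P D E F ⟩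
  D ⊛ (E ⊕ (P ⊛ (x ⊛ x)) ⊛ F) ⊕ (x ⊛ D) ⊛ (P ⊛ (E ⊕ F))
    ≈⟨ ⊕-cong (⊛-congˡ {D} (⊕-congˡ {E} (⊛-congʳ {F} (≗-sym z≗Px²))))
              (⊛-congˡ {x ⊛ D} (elementary-dilate k N)) ⟩
  D ⊛ (E ⊕ z ⊛ F) ⊕ (x ⊛ D) ⊛ (E ⊕ z ⊛ F)
    ≈⟨ solve 3 (λ x D X → D :* X :+ (x :* D) :* X := ((con 1 :+ x) :* D) :* X) ≗-refl x D (E ⊕ z ⊛ F) ⟩
  ((𝟙 ⊕ x) ⊛ D) ⊛ (E ⊕ z ⊛ F) ∎
  where
  open ≗-Reasoning
  N = k + suc L
  x = q ^ suc L
  z = (q ⊛ q) ^ suc N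
  P = (q ⊛ q) ^ suc k
  D = distinctProduct L
  E = elementary (suc k) N
  F = elementary k N
  z≗Px² : z ≗ P ⊛ (x ⊛ x)
  z≗Px² = begin
    z                            ≈⟨ ^-homo-* (q ⊛ q) (suc k) (suc L) ⟩
    P ⊛ (q ⊛ q) ^ suc L          ≈⟨ ⊛-congˡ {P} ([x⊛x]^n≗x^n⊛x^n q (suc L)) ⟩
    P ⊛ (x ⊛ x)                  ∎

-- Hooks of length two

module _ {A : Set} {P : Pred A 0ℓ} (P? : Decidable P) where

  length-filter-++ : ∀ xs ys →
    length (filter P? (xs ++ ys)) ≡ length (filter P? xs) + length (filter P? ys)
  length-filter-++ xs ys = trans (cong length (filter-++ P? xs ys)) (length-++ (filter P? xs))

  length-filter-map : ∀ {B : Set} (f : B → A) xs →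
    length (filter P? (map f xs)) ≡ length (filter (P? ∘ f) xs)
  length-filter-map f []       = refl
  length-filter-map f (x ∷ xs) with does (P? (f x))
  ... | true  = cong suc (length-filter-map f xs)
  ... | false = length-filter-map f xs

length-filter-upTo : ∀ j x → length (filter (j <?_) (upTo x)) ≡ x ∸ suc j
length-filter-upTo j zero    = refl
length-filter-upTo j (suc x) = begin
  length (filter (j <?_) (upTo (suc x)))
    ≡⟨ cong (length ∘ filter (j <?_)) (upTo-∷ʳ x) ⟨
  length (filter (j <?_) (upTo x ∷ʳ x))
    ≡⟨ length-filter-++ (j <?_) (upTo x) (x ∷ []) ⟩
  length (filter (j <?_) (upTo x)) + length (filter (j <?_) (x ∷ []))
    ≡⟨ cong (_+ length (filter (j <?_) (x ∷ []))) (length-filter-upTo j x) ⟩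
  x ∸ suc j + length (filter (j <?_) (x ∷ []))
    ≡⟨ last ⟩
  x ∸ j ∎
  where
  open ≡-Reasoning
  last : x ∸ suc j + length (filter (j <?_) (x ∷ [])) ≡ x ∸ j
  last with j <? x
  ... | yes j<x = trans (cong (x ∸ suc j +_) (cong length (filter-accept (j <?_) {xs = []} j<x)))
                        (trans (+-comm _ 1) (sym (+-∸-assoc 1 j<x)))
  ... | no  j≮x = trans (cong₂ _+_ (m≤n⇒m∸n≡0 (≤-trans (≮⇒≥ j≮x) (n≤1+n j)))
                                   (cong length (filter-reject (j <?_) {xs = []} j≮x)))
                        (sym (m≤n⇒m∸n≡0 (≮⇒≥ j≮x)))

firstRow : ℕ → Cell
firstRow = 0 ,_

nextRow : Cell → Cell
nextRow = map₁ suc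

module _ (x : ℕ) (xs : List ℕ) where
  private
    row rest : List Cell
    row  = map firstRow (upTo x)
    rest = map nextRow (cells xs)

  armLength-firstRow : ∀ j → length (filter (rightOf? (0 , j)) (cells (x ∷ xs))) ≡ x ∸ suc j
  armLength-firstRow j = begin
    length (filter (rightOf? (0 , j)) (row ++ rest))
      ≡⟨ length-filter-++ (rightOf? (0 , j)) row rest ⟩
    length (filter (rightOf? (0 , j)) row) + length (filter (rightOf? (0 , j)) rest)
      ≡⟨ cong₂ _+_ (trans (length-filter-map (rightOf? (0 , j)) firstRow (upTo x))
                          (cong length (filter-≐ _ (j <?_) (proj₂ , (refl ,_)) (upTo x))))
                   (cong length (filter-none (rightOf? (0 , j)) {xs = rest}
                     (All.map⁺ (All.tabulate {xs = cells xs} (λ _ ()))))) ⟩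
    length (filter (j <?_) (upTo x)) + 0
      ≡⟨ +-identityʳ _ ⟩
    length (filter (j <?_) (upTo x))
      ≡⟨ length-filter-upTo j x ⟩
    x ∸ suc j ∎
    where open ≡-Reasoning

  hookLength-firstRow : ∀ j →
    hookLength (x ∷ xs) (0 , j) ≡ suc (x ∸ suc j) + length (filter (below? (0 , j)) rest)
  hookLength-firstRow j = cong₂ (λ a l → suc a + l) (armLength-firstRow j) (begin
    length (filter (below? (0 , j)) (row ++ rest))
      ≡⟨ length-filter-++ (below? (0 , j)) row rest ⟩
    length (filter (below? (0 , j)) row) + length (filter (below? (0 , j)) rest)
      ≡⟨ cong (_+ _) (cong length (filter-none (below? (0 , j)) {xs = row}
           (All.map⁺ (All.tabulate {xs = upTo x} (λ _ ()))))) ⟩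
    length (filter (below? (0 , j)) rest) ∎)
    where open ≡-Reasoning

  -- Arms and legs extend only to the right and downwards, so removing the first row changes
  -- neither.
  hookLength-laterRow : ∀ i j → hookLength (x ∷ xs) (suc i , j) ≡ hookLength xs (i , j)
  hookLength-laterRow i j = cong₂ (λ a l → suc (a + l)) arm leg
    where
    open ≡-Reasoning
    arm = begin
      length (filter (rightOf? (suc i , j)) (row ++ rest))
        ≡⟨ length-filter-++ (rightOf? (suc i , j)) row rest ⟩
      length (filter (rightOf? (suc i , j)) row) + length (filter (rightOf? (suc i , j)) rest)
        ≡⟨ cong₂ _+_ (cong length (filter-none (rightOf? (suc i , j)) {xs = row}
                       (All.map⁺ (All.tabulate {xs = upTo x} (λ _ ())))))
                     (length-filter-map (rightOf? (suc i , j)) nextRow (cells xs)) ⟩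
      length (filter (rightOf? (suc i , j) ∘ nextRow) (cells xs))
        ≡⟨ cong length (filter-≐ _ (rightOf? (i , j)) (map₁ suc-injective , map₁ (cong suc)) (cells xs)) ⟩
      length (filter (rightOf? (i , j)) (cells xs)) ∎
    leg = begin
      length (filter (below? (suc i , j)) (row ++ rest))
        ≡⟨ length-filter-++ (below? (suc i , j)) row rest ⟩
      length (filter (below? (suc i , j)) row) + length (filter (below? (suc i , j)) rest)
        ≡⟨ cong₂ _+_ (cong length (filter-none (below? (suc i , j)) {xs = row}
                       (All.map⁺ (All.tabulate {xs = upTo x} (λ _ ())))))
                     (length-filter-map (below? (suc i , j)) nextRow (cells xs)) ⟩
      length (filter (below? (suc i , j) ∘ nextRow) (cells xs))
        ≡⟨ cong length (filter-≐ _ (below? (i , j)) (map₁ ≤-pred , map₁ s≤s) (cells xs)) ⟩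
      length (filter (below? (i , j)) (cells xs)) ∎

  hooksOfLength-∷ : ∀ k →
    hooksOfLength k (x ∷ xs) ≡
    length (filter (λ j → hookLength (x ∷ xs) (0 , j) ≟ k) (upTo x)) + hooksOfLength k xs
  hooksOfLength-∷ k = trans (length-filter-++ Q? row rest)
    (cong₂ _+_ (length-filter-map Q? firstRow (upTo x))
               (trans (length-filter-map Q? nextRow (cells xs))
                      (cong length (filter-≐ _ (λ c → hookLength xs c ≟ k)
                        ((λ {c} → trans (sym (hookLength-laterRow (proj₁ c) (proj₂ c))))
                        , (λ {c} → trans (hookLength-laterRow (proj₁ c) (proj₂ c)))) (cells xs)))))
    where
    Q? : Decidable (λ c → hookLength (x ∷ xs) c ≡ k)
    Q? c = hookLength (x ∷ xs) c ≟ k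

hooksOfLength-mono-∷ : ∀ k x xs → hooksOfLength k xs ≤ hooksOfLength k (x ∷ xs)
hooksOfLength-mono-∷ k x xs = subst (hooksOfLength k xs ≤_) (sym (hooksOfLength-∷ x xs k)) (m≤n+m _ _)

-- A cell with at least two cells to its right has hook length at least 3, so in the first row only
-- the last two columns matter.
hooks₂-∷ : ∀ M xs →
  hooksOfLength 2 (2 + M ∷ xs) ≡
  length (filter (λ j → hookLength (2 + M ∷ xs) (0 , j) ≟ 2) (M ∷ 1 + M ∷ [])) + hooksOfLength 2 xs
hooks₂-∷ M xs = trans (hooksOfLength-∷ (2 + M) xs 2) (cong (_+ hooksOfLength 2 xs) (begin
  length (filter Q? (upTo (2 + M)))
    ≡⟨ cong (length ∘ filter Q?) (upTo-∷ʳ (1 + M)) ⟨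
  length (filter Q? (upTo (1 + M) ++ 1 + M ∷ []))
    ≡⟨ cong (λ js → length (filter Q? (js ++ 1 + M ∷ []))) (upTo-∷ʳ M) ⟨
  length (filter Q? ((upTo M ++ M ∷ []) ++ 1 + M ∷ []))
    ≡⟨ cong (length ∘ filter Q?) (++-assoc (upTo M) (M ∷ []) (1 + M ∷ [])) ⟩
  length (filter Q? (upTo M ++ M ∷ 1 + M ∷ []))
    ≡⟨ length-filter-++ Q? (upTo M) (M ∷ 1 + M ∷ []) ⟩
  length (filter Q? (upTo M)) + length (filter Q? (M ∷ 1 + M ∷ []))
    ≡⟨ cong (λ js → length js + length (filter Q? (M ∷ 1 + M ∷ [])))
            (filter-none Q? (All.applyUpTo⁺₁ id M long)) ⟩
  length (filter Q? (M ∷ 1 + M ∷ [])) ∎))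
  where
  open ≡-Reasoning
  Q? : Decidable (λ j → hookLength (2 + M ∷ xs) (0 , j) ≡ 2)
  Q? j = hookLength (2 + M ∷ xs) (0 , j) ≟ 2
  long : ∀ {j} → j < M → hookLength (2 + M ∷ xs) (0 , j) ≢ 2
  long {j} j<M eq = <⇒≢ (≤-trans (s≤s arm) (m≤m+n _ _)) (sym (trans (sym (hookLength-firstRow (2 + M) xs j)) eq))
    where
    arm : 2 ≤ 2 + M ∸ suc j
    arm = subst (_≤ 2 + M ∸ suc j) (m+n∸n≡m 2 (suc j)) (∸-monoˡ-≤ (suc j) (s≤s (s≤s j<M)))

cells-column< : ∀ {M xs} → All (_≤ M) xs → All (λ c → proj₂ c < M) (cells xs)
cells-column< []         = []
cells-column< {M} {x ∷ xs} (x≤M ∷ xs≤M) =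
  All.++⁺ (All.map⁺ (All.applyUpTo⁺₁ id x (λ j<x → <-≤-trans j<x x≤M))) (All.map⁺ (cells-column< xs≤M))

legLength-zero : ∀ {M j xs} → All (_≤ M) xs → M ≤ j →
  length (filter (below? (0 , j)) (map nextRow (cells xs))) ≡ 0
legLength-zero {j = j} xs≤M M≤j = cong length (filter-none (below? (0 , j))
  (All.map⁺ (All.map (λ c<M (_ , c≡j) → <⇒≢ (<-≤-trans c<M M≤j) c≡j) (cells-column< xs≤M))))

arm-penultimate : ∀ M → 2 + M ∸ suc M ≡ 1
arm-penultimate M = m+n∸n≡m 1 (suc M)

-- The last two cells of the new row have empty legs, so their hook lengths are 2 and 1.
hooks₂-gap : ∀ {M xs} → All (_≤ M) xs → hooksOfLength 2 (2 + M ∷ xs) ≡ suc (hooksOfLength 2 xs)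
hooks₂-gap {M} {xs} xs≤M = trans (hooks₂-∷ M xs) (cong (_+ hooksOfLength 2 xs) (begin
  length (filter Q? (M ∷ 1 + M ∷ []))  ≡⟨ cong length (filter-accept Q? hook₂) ⟩
  suc (length (filter Q? (1 + M ∷ []))) ≡⟨ cong (suc ∘ length) (filter-reject Q? {xs = []} hook₁) ⟩
  1 ∎))
  where
  open ≡-Reasoning
  Q? : Decidable (λ j → hookLength (2 + M ∷ xs) (0 , j) ≡ 2)
  Q? j = hookLength (2 + M ∷ xs) (0 , j) ≟ 2
  hook₂ : hookLength (2 + M ∷ xs) (0 , M) ≡ 2
  hook₂ = trans (hookLength-firstRow (2 + M) xs M)
    (cong₂ (λ a l → suc a + l) (arm-penultimate M) (legLength-zero xs≤M ≤-refl))
  hook₁ : hookLength (2 + M ∷ xs) (0 , suc M) ≢ 2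
  hook₁ eq with () ← trans (sym eq) (trans (hookLength-firstRow (2 + M) xs (suc M))
    (cong₂ (λ a l → suc a + l) (n∸n≡0 M) (legLength-zero xs≤M (n≤1+n M))))

-- The penultimate cell of the new row has arm 1 and a nonempty leg, hence hook length at least 3;
-- the last cell still has hook length 1.
hooks₂-noGap : ∀ {M xs} → All (_≤ M) xs →
  hooksOfLength 2 (2 + M ∷ 1 + M ∷ xs) ≡ hooksOfLength 2 (1 + M ∷ xs)
hooks₂-noGap {M} {xs} xs≤M =
  trans (hooks₂-∷ M ys) (cong (λ js → length js + hooksOfLength 2 ys) (filter-none Q? (hook₃ ∷ hook₁ ∷ [])))
  where
  ys = 1 + M ∷ xs
  Q? : Decidable (λ j → hookLength (2 + M ∷ ys) (0 , j) ≡ 2)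
  Q? j = hookLength (2 + M ∷ ys) (0 , j) ≟ 2
  hook₃ : hookLength (2 + M ∷ ys) (0 , M) ≢ 2
  hook₃ eq = <⇒≢ (+-mono-≤ (≤-reflexive (cong suc (sym (arm-penultimate M))))
                             (filter-some (below? (0 , M)) below))
    (sym (trans (sym (hookLength-firstRow (2 + M) ys M)) eq))
    where
    below : Any (Below (0 , M)) (map nextRow (cells ys))
    -- The witness is the last cell of the row of length `1 + M` directly underneath.
    below = Any.map⁺ (Any.++⁺ˡ (Any.map⁺ (Any.applyUpTo⁺ id (s≤s z≤n , refl) (n<1+n M))))
  hook₁ : hookLength (2 + M ∷ ys) (0 , suc M) ≢ 2
  hook₁ eq with () ← trans (sym eq) (trans (hookLength-firstRow (2 + M) ys (suc M))
    (cong₂ (λ a l → suc a + l) (n∸n≡0 M) (legLength-zero {M = suc M} (≤-refl ∷ All.map m≤n⇒m≤1+n xs≤M) ≤-refl)))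

-- Sums over lists and generating functions of families of lists

module _ {A : Set} (f : A → ℕ) where

  sum-map-++ : ∀ xs ys → sum (map f (xs ++ ys)) ≡ sum (map f xs) + sum (map f ys)
  sum-map-++ xs ys = trans (cong sum (map-++ f xs ys)) (sum-++ (map f xs) (map f ys))

  sum-map-zero : ∀ {xs} → All (λ x → f x ≡ 0) xs → sum (map f xs) ≡ 0
  sum-map-zero []             = refl
  sum-map-zero (fx≡0 ∷ fxs≡0) = cong₂ _+_ fx≡0 (sum-map-zero fxs≡0)

  -- Each entry of `xs` is matched with an occurrence in `ys`, which is then removed; uniqueness of
  -- `xs` keeps its remaining entries inside the remaining list. Such containments take the place of
  -- explicit injections below.
  sum-map-⊆ : ∀ {xs ys} → Unique xs → xs ⊆ ys → sum (map f xs) ≤ sum (map f ys)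
  sum-map-⊆ {[]}     _             _     = z≤n
  sum-map-⊆ {x ∷ xs} (x∉xs ∷ uniq) xs⊆ys with ∈-∃++ (xs⊆ys (here refl))
  ... | as , bs , refl = begin
    f x + sum (map f xs)          ≤⟨ +-monoʳ-≤ (f x) (sum-map-⊆ uniq xs⊆) ⟩
    f x + sum (map f (as ++ bs))  ≡⟨ sum-↭ (↭.map⁺ f (↭.shift x as bs)) ⟨
    sum (map f (as ++ x ∷ bs))    ∎
    where
    open ≤-Reasoning
    xs⊆ : xs ⊆ as ++ bs
    xs⊆ y∈xs with ∈-++⁻ as (xs⊆ys (there y∈xs))
    ... | inj₁ y∈as         = ∈-++⁺ˡ y∈as
    ... | inj₂ (here refl)  = contradiction refl (All.lookup x∉xs y∈xs)
    ... | inj₂ (there y∈bs) = ∈-++⁺ʳ as y∈bs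

sum-map-+ : ∀ {A : Set} (f g : A → ℕ) xs → sum (map (λ x → f x + g x) xs) ≡ sum (map f xs) + sum (map g xs)
sum-map-+ f g []       = refl
sum-map-+ f g (x ∷ xs) =
  trans (cong (f x + g x +_) (sum-map-+ f g xs)) (interchange +-commutativeSemigroup (f x) (g x) _ _)

sum-map-mono-≤ : ∀ {A : Set} {f g : A → ℕ} {xs} → All (λ x → f x ≤ g x) xs → sum (map f xs) ≤ sum (map g xs)
sum-map-mono-≤ []       = z≤n
sum-map-mono-≤ (p ∷ ps) = +-mono-≤ p (sum-map-mono-≤ ps)

sum-map-upTo-single : ∀ {f : ℕ → ℕ} {i} → (∀ m → m ≢ i → f m ≡ 0) → ∀ n → i < n →
  sum (map f (upTo n)) ≡ f i
sum-map-upTo-single {f} {i} f≡0 (suc n) i<1+n = begin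
  sum (map f (upTo (suc n)))             ≡⟨ cong (sum ∘ map f) (upTo-∷ʳ n) ⟨
  sum (map f (upTo n ++ n ∷ []))         ≡⟨ sum-map-++ f (upTo n) (n ∷ []) ⟩
  sum (map f (upTo n)) + (f n + 0)       ≡⟨ cong (sum (map f (upTo n)) +_) (+-identityʳ (f n)) ⟩
  sum (map f (upTo n)) + f n             ≡⟨ lemma ⟩
  f i                                    ∎
  where
  open ≡-Reasoning
  lemma : sum (map f (upTo n)) + f n ≡ f i
  lemma with i ≟ n
  ... | yes refl = cong (_+ f n) (sum-map-zero f (All.applyUpTo⁺₁ _ n λ m<n → f≡0 _ (<⇒≢ m<n)))
  ... | no  i≢n  = trans (cong₂ _+_ (sum-map-upTo-single f≡0 n (≤∧≢⇒< (≤-pred i<1+n) i≢n)) (f≡0 n (i≢n ∘ sym)))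
                         (+-identityʳ (f i))

module _ {A : Set} {P : Pred A 0ℓ} (P? : Decidable P) {Q : ℕ → Pred A 0ℓ} (Q? : ∀ m → Decidable (Q m))
         (g : ℕ → ℕ) (h : A → ℕ) (Q⇔P : ∀ {m x} → Q m x ⇔ (P x × h x ≡ m)) where

  -- Double counting: an entry `x` satisfying `P` contributes only at m = h x, which lies in the
  -- range of summation because `h x ≤ n`; other entries contribute nowhere.
  ∑-by-value : ∀ n xs → All (λ x → h x ≤ n) xs →
    (∑[ m ≤ n ] g m * length (filter (Q? m) xs)) ≡ sum (map (g ∘ h) (filter P? xs))
  ∑-by-value n []       []          = sum-map-zero _ (All.tabulate {xs = upTo (suc n)} λ {m} _ → *-zeroʳ (g m))
  ∑-by-value n (x ∷ xs) (hx≤n ∷ hxs≤n) = begin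
    (∑[ m ≤ n ] g m * length (filter (Q? m) (x ∷ xs)))
      ≡⟨ cong sum (map-cong (λ m → trans (cong (g m *_) (length-filter-++ (Q? m) (x ∷ []) xs))
                                          (*-distribˡ-+ (g m) _ _))
                            (upTo (suc n))) ⟩
    (∑[ m ≤ n ] (single m + g m * length (filter (Q? m) xs)))
      ≡⟨ sum-map-+ single _ (upTo (suc n)) ⟩
    (∑[ m ≤ n ] single m) + (∑[ m ≤ n ] g m * length (filter (Q? m) xs))
      ≡⟨ cong ((∑[ m ≤ n ] single m) +_) (∑-by-value n xs hxs≤n) ⟩
    (∑[ m ≤ n ] single m) + sum (map (g ∘ h) (filter P? xs))
      ≡⟨ head ⟩
    sum (map (g ∘ h) (filter P? (x ∷ xs))) ∎
    where
    open ≡-Reasoning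
    open Equivalence
    single : ℕ → ℕ
    single m = g m * length (filter (Q? m) (x ∷ []))
    single-zero : ∀ m → ¬ Q m x → single m ≡ 0
    single-zero m ¬Q = trans (cong (λ ys → g m * length ys) (filter-reject (Q? m) {xs = []} ¬Q)) (*-zeroʳ (g m))
    head : (∑[ m ≤ n ] single m) + sum (map (g ∘ h) (filter P? xs)) ≡ sum (map (g ∘ h) (filter P? (x ∷ xs)))
    head with P? x
    ... | yes Px = cong (_+ sum (map (g ∘ h) (filter P? xs))) (trans
      (sum-map-upTo-single (λ m m≢hx → single-zero m (m≢hx ∘ sym ∘ proj₂ ∘ to Q⇔P)) (suc n) (s≤s hx≤n))
      (trans (cong (λ ys → g (h x) * length ys) (filter-accept (Q? (h x)) {xs = []} (from Q⇔P (Px , refl))))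
             (*-identityʳ _)))
    ... | no ¬Px = cong (_+ sum (map (g ∘ h) (filter P? xs)))
      (sum-map-zero _ (All.tabulate {xs = upTo (suc n)} (λ {m} _ → single-zero m (¬Px ∘ proj₁ ∘ to Q⇔P))))

module _ {A : Set} {P : Pred A 0ℓ} (P? : Decidable P) (f g h : A → ℕ) where

  -- In the application `P` says that the remaining parts leave a gap, and `h` is the extra term
  -- that Pascal's rule gives in this case.
  sum-map-≤-split : ∀ {xs} → All (λ x → (P x → f x ≤ g x + h x) × (¬ P x → f x ≤ g x)) xs →
    sum (map f xs) ≤ sum (map g xs) + sum (map h (filter P? xs))
  sum-map-≤-split []                 = z≤n
  sum-map-≤-split {x ∷ xs} ((p , ¬p) ∷ ps) with P? x
  ... | yes Px = ≤-trans (+-mono-≤ (p Px) (sum-map-≤-split ps))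
                         (≤-reflexive (interchange +-commutativeSemigroup (g x) (h x) _ _))
  ... | no ¬Px = ≤-trans (+-mono-≤ (¬p ¬Px) (sum-map-≤-split ps)) (≤-reflexive (sym (+-assoc (g x) _ _)))

  sum-map-≥-split : ∀ {xs} → All (λ x → (P x → g x + h x ≤ f x) × g x ≤ f x) xs →
    sum (map g xs) + sum (map h (filter P? xs)) ≤ sum (map f xs)
  sum-map-≥-split []                 = z≤n
  sum-map-≥-split {x ∷ xs} ((p , g≤f) ∷ ps) with P? x
  ... | yes Px = ≤-trans (≤-reflexive (interchange +-commutativeSemigroup (g x) _ (h x) _))
                         (+-mono-≤ (p Px) (sum-map-≥-split ps))
  ... | no ¬Px = ≤-trans (≤-reflexive (+-assoc (g x) _ _)) (+-mono-≤ g≤f (sum-map-≥-split ps))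

weight : {A : Set} → (A → ℕ) → (ℕ → List A) → Series
weight f c n = sum (map f (c n))

-- Multiplication by qˢ at the level of lists: the family is shifted by `s`, with empty lists at the
-- indices below `s`.
delay : {A : Set} → ℕ → (ℕ → List A) → ℕ → List A
delay zero    c n       = c n
delay (suc s) c zero    = []
delay (suc s) c (suc n) = delay s c n

module _ {A : Set} where

  weight-delay : ∀ (f : A → ℕ) s c → weight f (delay s c) ≗ (q ^ s) ⊛ weight f c
  weight-delay f zero    c n       = sym (⊛-identityˡ (weight f c) n)
  weight-delay f (suc s) c zero    = refl
  weight-delay f (suc s) c (suc n) = trans (weight-delay f s c n)
    (sym (trans (qs⊛ s (weight f c) (suc n)) (q⊛-suc _ n)))

  ∈-delay⁺ : ∀ {x : A} s c n → x ∈ c n → x ∈ delay s c (s + n)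
  ∈-delay⁺ zero    c n x∈ = x∈
  ∈-delay⁺ (suc s) c n x∈ = ∈-delay⁺ s c n x∈

  ∈-delay⁻ : ∀ {x : A} s c n → x ∈ delay s c n → ∃ λ m → n ≡ s + m × x ∈ c m
  ∈-delay⁻ zero    c n       x∈ = n , refl , x∈
  ∈-delay⁻ (suc s) c (suc n) x∈ with m , eq , x∈c ← ∈-delay⁻ s c n x∈ = m , cong suc eq , x∈c

  delay-unique : ∀ s {c : ℕ → List A} → (∀ n → Unique (c n)) → ∀ n → Unique (delay s c n)
  delay-unique zero    uniq n       = uniq n
  delay-unique (suc s) uniq zero    = []
  delay-unique (suc s) uniq (suc n) = delay-unique s uniq n

-- Binomial coefficients

nCk≤[1+n]Ck : ∀ n k → n C k ≤ suc n C k
nCk≤[1+n]Ck n zero    = ≤-refl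
nCk≤[1+n]Ck n (suc k) = subst (n C suc k ≤_) (nCk+nC[k+1]≡[n+1]C[k+1] n k) (m≤n+m _ _)

C-monoˡ-≤ : ∀ k {m n} → m ≤ n → m C k ≤ n C k
C-monoˡ-≤ k = mono ∘ ≤⇒≤′
  where
  mono : ∀ {m n} → m ≤′ n → m C k ≤ n C k
  mono ≤′-refl        = ≤-refl
  mono (≤′-step m≤′n) = ≤-trans (mono m≤′n) (nCk≤[1+n]Ck _ k)

[1+n]C[1+k] : ∀ n k → suc n C suc k ≡ n C suc k + n C k
[1+n]C[1+k] n k = trans (sym (nCk+nC[k+1]≡[n+1]C[k+1] n k)) (+-comm (n C k) _)

-- Families of partitions and the removal of the largest part

isPartition-head : ∀ {n x xs} → IsPartition n (x ∷ xs) → All (_≤ x) xs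
isPartition-head π = AllPairs.head (Linked⇒AllPairs (λ j≤i k≤j → ≤-trans k≤j j≤i) (nonincreasing π))

isPartition-tail : ∀ {n x xs} → IsPartition n (x ∷ xs) → ∃ λ m → n ≡ x + m × IsPartition m xs
isPartition-tail π =
  _ , sym (size π) , isPartition (Linked.tail (nonincreasing π)) (All.tail (positive π)) refl

isPartition-∷ : ∀ {n x xs} → 0 < x → All (_≤ x) xs → IsPartition n xs → IsPartition (x + n) (x ∷ xs)
isPartition-∷ {x = x} 0<x xs≤x π =
  isPartition (linked xs≤x (nonincreasing π)) (0<x ∷ positive π) (cong (x +_) (size π))
  where
  linked : ∀ {xs} → All (_≤ x) xs → Linked _≥_ xs → Linked _≥_ (x ∷ xs)
  linked []        []  = [-]
  linked (y≤x ∷ _) dec = y≤x ∷ dec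

module _ {P : Pred (List ℕ) 0ℓ} (P? : Decidable P) where

  partitionsWith : ℕ → List (List ℕ)
  partitionsWith n = filter P? (partitions n)

  ∈-partitionsWith⁺ : ∀ {n xs} → IsPartition n xs → P xs → xs ∈ partitionsWith n
  ∈-partitionsWith⁺ {n} {xs} π = ∈-filter⁺ P? (Equivalence.from (∈-partitions n xs) π)

  ∈-partitionsWith⁻ : ∀ {n xs} → xs ∈ partitionsWith n → IsPartition n xs × P xs
  ∈-partitionsWith⁻ {n} {xs} xs∈ with xs∈′ , Pxs ← ∈-filter⁻ P? {xs = partitions n} xs∈ =
    Equivalence.to (∈-partitions n xs) xs∈′ , Pxs

  partitionsWith-unique : ∀ n → Unique (partitionsWith n)
  partitionsWith-unique n = Unique.filter⁺ P? (partitions-unique n)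

  -- Binomial moments of the hook count; order 0 gives the ordinary generating function, since h C 0
  -- = 1.
  hookMoment : ℕ → Series
  hookMoment k = weight (λ xs → hooksOfLength 2 xs C k) partitionsWith

module _ {P Q R : Pred (List ℕ) 0ℓ} (P? : Decidable P) (Q? : Decidable Q) (R? : Decidable R)
         (s : ℕ) (f : List ℕ → ℕ) where
  private
    pieces : ℕ → List (List ℕ)
    pieces n = partitionsWith Q? n ++ map (s ∷_) (delay s (partitionsWith R?) n)

    sum-pieces : ∀ n → sum (map f (pieces n)) ≡
      (weight f (partitionsWith Q?) ⊕ (q ^ s) ⊛ weight (f ∘ (s ∷_)) (partitionsWith R?)) n
    sum-pieces n = trans (sum-map-++ f (partitionsWith Q? n) _)
      (cong (sum (map f (partitionsWith Q? n)) +_)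
        (trans (cong sum (sym (map-∘ (delay s (partitionsWith R?) n))))
               (weight-delay (f ∘ (s ∷_)) s (partitionsWith R?) n)))

  -- The two pieces cover the duplicate-free list of partitions. Removing the head `s` lowers the
  -- size by `s`, which `delay` records as the factor qˢ.
  weight-≼-split : (∀ {n xs} → IsPartition n xs → P xs → Q xs ⊎ ∃ λ ys → xs ≡ s ∷ ys × R ys) →
    weight f (partitionsWith P?) ≼
    weight f (partitionsWith Q?) ⊕ (q ^ s) ⊛ weight (f ∘ (s ∷_)) (partitionsWith R?)
  weight-≼-split split n =
    ≤-trans (sum-map-⊆ f (partitionsWith-unique P? n) cover) (≤-reflexive (sum-pieces n))
    where
    cover : partitionsWith P? n ⊆ pieces n
    cover xs∈ with π , Pxs ← ∈-partitionsWith⁻ P? {n} xs∈ with split π Pxs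
    ... | inj₁ Qxs               = ∈-++⁺ˡ (∈-partitionsWith⁺ Q? π Qxs)
    ... | inj₂ (ys , refl , Rys) with m , refl , π′ ← isPartition-tail π =
      ∈-++⁺ʳ (partitionsWith Q? n)
        (∈-map⁺ (s ∷_) (∈-delay⁺ s (partitionsWith R?) m (∈-partitionsWith⁺ R? π′ Rys)))

  -- The converse containment. Nothing is counted twice: prepending `s` is injective, and no list in
  -- `Q` starts with `s`.
  weight-≽-split : 0 < s → (∀ {xs} → Q xs → P xs) → (∀ {ys} → ¬ Q (s ∷ ys)) →
    (∀ {ys} → R ys → All (_≤ s) ys × P (s ∷ ys)) →
    weight f (partitionsWith Q?) ⊕ (q ^ s) ⊛ weight (f ∘ (s ∷_)) (partitionsWith R?) ≼
    weight f (partitionsWith P?)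
  weight-≽-split 0<s Q⇒P ¬Q R⇒P n =
    ≤-trans (≤-reflexive (sym (sum-pieces n))) (sum-map-⊆ f unique contained)
    where
    unique : Unique (pieces n)
    unique = Unique.++⁺ (partitionsWith-unique Q? n)
      (Unique.map⁺ ∷-injectiveʳ (delay-unique s (partitionsWith-unique R?) n)) disjoint
      where
      disjoint : Disjoint (partitionsWith Q? n) (map (s ∷_) (delay s (partitionsWith R?) n))
      disjoint (xs∈ , xs∈′) with _ , _ , refl ← ∈-map⁻ (s ∷_) xs∈′ = ¬Q (proj₂ (∈-partitionsWith⁻ Q? {n} xs∈))
    contained : pieces n ⊆ partitionsWith P? n
    contained xs∈ with ∈-++⁻ (partitionsWith Q? n) xs∈
    ... | inj₁ xs∈Q with π , Qxs ← ∈-partitionsWith⁻ Q? {n} xs∈Q = ∈-partitionsWith⁺ P? π (Q⇒P Qxs)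
    ... | inj₂ xs∈R with ys , ys∈ , refl ← ∈-map⁻ (s ∷_) xs∈R
                    with m , refl , ys∈R ← ∈-delay⁻ s (partitionsWith R?) n ys∈
                    with π , Rys ← ∈-partitionsWith⁻ R? {m} ys∈R =
      ∈-partitionsWith⁺ P? (isPartition-∷ 0<s (proj₁ (R⇒P Rys)) π) (proj₂ (R⇒P Rys))

-- Partitions into distinct parts

DistinctUpTo OddUpTo : ℕ → List ℕ → Set
DistinctUpTo L xs = Unique xs × All (_≤ L) xs
OddUpTo L xs      = All Odd xs × All (_≤ 2 * L ∸ 1) xs

distinctUpTo? : ∀ L → Decidable (DistinctUpTo L)
distinctUpTo? L xs = unique? xs ×-dec All.all? (_≤? L) xs

oddUpTo? : ∀ L → Decidable (OddUpTo L)
oddUpTo? L xs = All.all? odd? xs ×-dec All.all? (_≤? 2 * L ∸ 1) xs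

module _ (L : ℕ) where

  -- The first part is the largest one. If it equals `suc L`, distinctness forces all others to be
  -- at most `L`.
  distinctUpTo-split : ∀ {n xs} → IsPartition n xs → DistinctUpTo (suc L) xs →
    DistinctUpTo L xs ⊎ ∃ λ ys → xs ≡ suc L ∷ ys × DistinctUpTo L ys
  distinctUpTo-split {xs = []}     π (uniq , _) = inj₁ (uniq , [])
  distinctUpTo-split {xs = x ∷ xs} π (x∉ ∷ uniq , x≤ ∷ xs≤) with m≤n⇒m<n∨m≡n x≤
  ... | inj₁ (s≤s x≤L) = inj₁ (x∉ ∷ uniq , x≤L ∷ All.map (λ y≤x → ≤-trans y≤x x≤L) (isPartition-head π))
  ... | inj₂ refl      = inj₂ (xs , refl , uniq , below (isPartition-head π) x∉)
    where
    below : ∀ {ys} → All (_≤ suc L) ys → All (suc L ≢_) ys → All (_≤ L) ys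
    below []       []       = []
    below (p ∷ ps) (r ∷ rs) = ≤-pred (≤∧≢⇒< p (r ∘ sym)) ∷ below ps rs

  distinctUpTo-step : ∀ k →
    hookMoment (distinctUpTo? (suc L)) k ≼
    hookMoment (distinctUpTo? L) k ⊕
    (q ^ suc L) ⊛ weight (λ xs → hooksOfLength 2 (suc L ∷ xs) C k) (partitionsWith (distinctUpTo? L))
  distinctUpTo-step k =
    weight-≼-split (distinctUpTo? (suc L)) (distinctUpTo? L) (distinctUpTo? L) (suc L) _ distinctUpTo-split

-- Here the largest part must be exactly `suc M`, so the new part exceeds it by one.
distinctUpTo-noGap : ∀ {M n xs} → IsPartition n xs → DistinctUpTo (suc M) xs → ¬ All (_≤ M) xs →
  hooksOfLength 2 (2 + M ∷ xs) ≤ hooksOfLength 2 xs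
distinctUpTo-noGap {M} π D ¬small with distinctUpTo-split M π D
... | inj₁ (_ , xs≤M)             = contradiction xs≤M ¬small
... | inj₂ (ys , refl , _ , ys≤M) = ≤-reflexive (hooks₂-noGap ys≤M)

-- Prepending `2 + L` creates a new hook only when all other parts are at most `L`. Pascal's rule
-- then adds the moment of order `k`, taken over the smaller family.
distinctUpTo-gap : ∀ k L →
  weight (λ xs → hooksOfLength 2 (2 + L ∷ xs) C suc k) (partitionsWith (distinctUpTo? (suc L))) ≼
  hookMoment (distinctUpTo? (suc L)) (suc k) ⊕ hookMoment (distinctUpTo? L) k
distinctUpTo-gap k L n = ≤-trans
  (sum-map-≤-split small? _ (λ xs → hooksOfLength 2 xs C suc k) (λ xs → hooksOfLength 2 xs C k)
    (All.tabulate λ {xs} xs∈ →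
      (λ xs≤L → ≤-reflexive (trans (cong (_C suc k) (hooks₂-gap xs≤L)) ([1+n]C[1+k] (hooksOfLength 2 xs) k)))
      , λ ¬small → let π , D = ∈-partitionsWith⁻ (distinctUpTo? (suc L)) {n} xs∈ in
                   C-monoˡ-≤ (suc k) (distinctUpTo-noGap π D ¬small)))
  (+-monoʳ-≤ _ (sum-map-⊆ _ (Unique.filter⁺ small? (partitionsWith-unique (distinctUpTo? (suc L)) n)) sub))
  where
  small? : Decidable (All (_≤ L))
  small? = All.all? (_≤? L)
  sub : filter small? (partitionsWith (distinctUpTo? (suc L)) n) ⊆ partitionsWith (distinctUpTo? L) n
  sub xs∈ with xs∈′ , xs≤L ← ∈-filter⁻ small? {xs = partitionsWith (distinctUpTo? (suc L)) n} xs∈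
          with π , uniq , _ ← ∈-partitionsWith⁻ (distinctUpTo? (suc L)) {n} xs∈′ =
    ∈-partitionsWith⁺ (distinctUpTo? L) π (uniq , xs≤L)

-- Only the empty partition and the single part 1 occur.
distinctUpTo-one : ∀ {n xs} → IsPartition n xs → DistinctUpTo 1 xs → hooksOfLength 2 xs ≡ 0
distinctUpTo-one {xs = []}             _ _ = refl
distinctUpTo-one {xs = 1 ∷ []}         _ _ = refl
distinctUpTo-one {xs = 1 ∷ 1 ∷ xs}     _ ((1≢1 ∷ _) ∷ _ , _) = contradiction refl 1≢1
distinctUpTo-one {xs = 0 ∷ xs}         π _ with () ← All.head (positive π)
distinctUpTo-one {xs = 1 ∷ 0 ∷ xs}     π _ with () ← All.head (All.tail (positive π))
distinctUpTo-one {xs = suc (suc x) ∷ xs} _ (_ , s≤s () ∷ _)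
distinctUpTo-one {xs = 1 ∷ suc (suc x) ∷ xs} _ (_ , _ ∷ s≤s () ∷ _)

hookMoment-distinct-one : ∀ k → hookMoment (distinctUpTo? 1) (suc k) ≼ 𝟘
hookMoment-distinct-one k n = ≤-reflexive (sum-map-zero _ (All.tabulate λ xs∈ →
  let π , D = ∈-partitionsWith⁻ (distinctUpTo? 1) {n} xs∈ in cong (_C suc k) (distinctUpTo-one π D)))

hookMoment-distinct-zero : ∀ k → hookMoment (distinctUpTo? 0) (suc k) ≼ 𝟘
hookMoment-distinct-zero k n = ≤-reflexive (sum-map-zero _ (All.tabulate λ xs∈ →
  let π , uniq , ≤0 = ∈-partitionsWith⁻ (distinctUpTo? 0) {n} xs∈ in
  cong (_C suc k) (distinctUpTo-one π (uniq , All.map m≤n⇒m≤1+n ≤0))))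

distinctUpTo-zero-empty : ∀ n → partitionsWith (distinctUpTo? 0) (suc n) ⊆ []
distinctUpTo-zero-empty n {[]} xs∈ with () ← size (proj₁ (∈-partitionsWith⁻ (distinctUpTo? 0) {suc n} xs∈))
distinctUpTo-zero-empty n {x ∷ xs} xs∈ with π , _ , z≤n ∷ _ ← ∈-partitionsWith⁻ (distinctUpTo? 0) {suc n} xs∈
                                      with () ← All.head (positive π)

-- Induction along the recurrence of `distinctMoment`: the largest part is split off, and the hook
-- that it creates is accounted for by `distinctUpTo-gap`.
hookMoment-distinct-≼ : ∀ k L → hookMoment (distinctUpTo? L) k ≼ distinctMoment k L
hookMoment-distinct-≼ zero    zero    zero    = ≤-refl
hookMoment-distinct-≼ zero    zero    (suc n) =
  sum-map-⊆ _ (partitionsWith-unique (distinctUpTo? 0) (suc n)) (distinctUpTo-zero-empty n)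
hookMoment-distinct-≼ zero    (suc L) = begin
  hookMoment (distinctUpTo? (suc L)) 0       ≲⟨ distinctUpTo-step L 0 ⟩
  m ⊕ x ⊛ m                                  ≈⟨ solve 2 (λ x m → m :+ x :* m := (con 1 :+ x) :* m) ≗-refl x m ⟩
  (𝟙 ⊕ x) ⊛ m                                ≲⟨ ⊛-mono-≼ ≼-refl (hookMoment-distinct-≼ 0 L) ⟩
  (𝟙 ⊕ x) ⊛ distinctProduct L                ∎
  where
  open ≼-Reasoning
  x = q ^ suc L
  m = hookMoment (distinctUpTo? L) 0
hookMoment-distinct-≼ (suc k) zero          = hookMoment-distinct-zero k
hookMoment-distinct-≼ (suc k) (suc zero)    = hookMoment-distinct-one k
hookMoment-distinct-≼ (suc k) (suc (suc L)) = begin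
  hookMoment (distinctUpTo? (2 + L)) (suc k)
    ≲⟨ distinctUpTo-step (suc L) (suc k) ⟩
  m ⊕ x ⊛ weight (λ xs → hooksOfLength 2 (2 + L ∷ xs) C suc k) (partitionsWith (distinctUpTo? (suc L)))
    ≲⟨ ⊕-mono-≼ ≼-refl (⊛-mono-≼ ≼-refl (distinctUpTo-gap k L)) ⟩
  m ⊕ x ⊛ (m ⊕ m′)
    ≈⟨ solve 3 (λ x m m′ → m :+ x :* (m :+ m′) := (con 1 :+ x) :* m :+ x :* m′) ≗-refl x m m′ ⟩
  (𝟙 ⊕ x) ⊛ m ⊕ x ⊛ m′
    ≲⟨ ⊕-mono-≼ (⊛-mono-≼ ≼-refl (hookMoment-distinct-≼ (suc k) (suc L)))
                  (⊛-mono-≼ ≼-refl (hookMoment-distinct-≼ k L)) ⟩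
  distinctMoment (suc k) (2 + L) ∎
  where
  open ≼-Reasoning
  x  = q ^ (2 + L)
  m  = hookMoment (distinctUpTo? (suc L)) (suc k)
  m′ = hookMoment (distinctUpTo? L) k

-- Partitions into odd parts

-- The factor `geometric (L + L)` is 1 / (1 - q²ᴸ⁺¹), as the argument of `geometric` is one less
-- than the exponent.
oddProduct : ℕ → Series
oddProduct zero    = 𝟙
oddProduct (suc L) = geometric (L + L) ⊛ oddProduct L

-- The product of 1 / (1 - qᵃ⁺ⁱ) over 1 ≤ i ≤ k.
geometricProduct : ℕ → ℕ → Series
geometricProduct a zero    = 𝟙
geometricProduct a (suc k) = geometric a ⊛ geometricProduct (suc a) k

geometricProduct-snoc : ∀ a k → geometricProduct a (suc k) ≗ geometricProduct a k ⊛ geometric (a + k)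
geometricProduct-snoc a zero    = begin
  geometric a ⊛ 𝟙          ≈⟨ ⊛-comm (geometric a) 𝟙 ⟩
  𝟙 ⊛ geometric a          ≡⟨ cong (λ b → 𝟙 ⊛ geometric b) (+-identityʳ a) ⟨
  𝟙 ⊛ geometric (a + 0)    ∎
  where open ≗-Reasoning
geometricProduct-snoc a (suc k) = begin
  geometric a ⊛ geometricProduct (suc a) (suc k)
    ≈⟨ ⊛-congˡ {geometric a} (geometricProduct-snoc (suc a) k) ⟩
  geometric a ⊛ (geometricProduct (suc a) k ⊛ geometric (suc a + k))
    ≈⟨ ⊛-assoc (geometric a) (geometricProduct (suc a) k) (geometric (suc a + k)) ⟨
  geometricProduct a (suc k) ⊛ geometric (suc a + k)
    ≡⟨ cong (λ b → geometricProduct a (suc k) ⊛ geometric b) (+-suc a k) ⟨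
  geometricProduct a (suc k) ⊛ geometric (a + suc k) ∎
  where open ≗-Reasoning

-- The identity 1 / (1 - x) = (1 + x) / (1 - x²) for x = qᵗ⁺¹: unfolding the fixpoint equation twice
-- gives the equation that determines the right side.
geometric-double : ∀ t → geometric t ≗ (𝟙 ⊕ q ^ suc t) ⊛ geometric (t + suc t)
geometric-double t = begin
  g                                       ≈⟨ ≗-geometric⊛ (t + suc t) (𝟙 ⊕ x) unfold ⟩
  geometric (t + suc t) ⊛ (𝟙 ⊕ x)         ≈⟨ ⊛-comm (geometric (t + suc t)) (𝟙 ⊕ x) ⟩
  (𝟙 ⊕ x) ⊛ geometric (t + suc t)         ∎
  where
  open ≗-Reasoning
  g = geometric t
  x = q ^ suc t
  unfold : g ≗ (𝟙 ⊕ x) ⊕ (q ^ suc (t + suc t)) ⊛ g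
  unfold = begin
    g                             ≈⟨ geometric-unfold t ⟩
    𝟙 ⊕ x ⊛ g                     ≈⟨ ⊕-congˡ {𝟙} (⊛-congˡ {x} (geometric-unfold t)) ⟩
    𝟙 ⊕ x ⊛ (𝟙 ⊕ x ⊛ g)
      ≈⟨ solve 2 (λ x g → con 1 :+ x :* (con 1 :+ x :* g) := (con 1 :+ x) :+ (x :* x) :* g) ≗-refl x g ⟩
    (𝟙 ⊕ x) ⊕ (x ⊛ x) ⊛ g         ≈⟨ ⊕-congˡ {𝟙 ⊕ x} (⊛-congʳ {g} (^-homo-* q (suc t) (suc t))) ⟨
    (𝟙 ⊕ x) ⊕ (q ^ suc (t + suc t)) ⊛ g ∎

-- (q; q)₂ᴸ = ∏ᵢ (1 − q²ⁱ) (1 − q²ⁱ⁻¹) and 1 + qⁱ = (1 − q²ⁱ) / (1 − qⁱ), so that the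
-- quotient of the two products is 1 / ∏ᵢ (1 − qᴸ⁺ⁱ), where 1 ≤ i ≤ L throughout.
distinctProduct⊛geometricProduct : ∀ L → distinctProduct L ⊛ geometricProduct L L ≗ oddProduct L
distinctProduct⊛geometricProduct zero    = ⊛-identityˡ 𝟙
distinctProduct⊛geometricProduct (suc L) = begin
  ((𝟙 ⊕ x) ⊛ D) ⊛ geometricProduct (suc L) (suc L)
    ≈⟨ ⊛-congˡ {(𝟙 ⊕ x) ⊛ D} (geometricProduct-snoc (suc L) L) ⟩
  ((𝟙 ⊕ x) ⊛ D) ⊛ (Π ⊛ geometric (suc L + L))
    ≡⟨ cong (λ b → ((𝟙 ⊕ x) ⊛ D) ⊛ (Π ⊛ geometric b)) (+-suc L L) ⟨
  ((𝟙 ⊕ x) ⊛ D) ⊛ (Π ⊛ geometric (L + suc L))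
    -- The factor 1 / (1 - q²ᴸ⁺²) is paired with 1 + qᴸ⁺¹. They merge into 1 / (1 - qᴸ⁺¹), so the
    -- exponents now run from L + 1 to 2L + 1, and the last of them is the new odd one.
    ≈⟨ solve 4 (λ y D Π g → (y :* D) :* (Π :* g) := D :* ((y :* g) :* Π))
         ≗-refl (𝟙 ⊕ x) D Π (geometric (L + suc L)) ⟩
  D ⊛ (((𝟙 ⊕ x) ⊛ geometric (L + suc L)) ⊛ Π)
    ≈⟨ ⊛-congˡ {D} (⊛-congʳ {Π} (geometric-double L)) ⟨
  D ⊛ geometricProduct L (suc L)
    ≈⟨ ⊛-congˡ {D} (geometricProduct-snoc L L) ⟩
  D ⊛ (geometricProduct L L ⊛ geometric (L + L))
    ≈⟨ solve 3 (λ D Π g → D :* (Π :* g) := g :* (D :* Π)) ≗-refl D (geometricProduct L L) (geometric (L + L)) ⟩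
  geometric (L + L) ⊛ (D ⊛ geometricProduct L L)
    ≈⟨ ⊛-congˡ {geometric (L + L)} (distinctProduct⊛geometricProduct L) ⟩
  oddProduct (suc L) ∎
  where
  open ≗-Reasoning
  x = q ^ suc L
  D = distinctProduct L
  Π = geometricProduct (suc L) L

-- Comparison of the products and the closed forms

f≼f⊕g : ∀ {f} g → f ≼ f ⊕ g
f≼f⊕g g n = m≤m+n _ (g n)

𝟙≼geometric : ∀ t → 𝟙 ≼ geometric t
𝟙≼geometric t zero    = ≤-refl
𝟙≼geometric t (suc n) = z≤n

𝟙≼geometricProduct : ∀ a k → 𝟙 ≼ geometricProduct a k
𝟙≼geometricProduct a zero    = ≼-refl
𝟙≼geometricProduct a (suc k) = begin
  𝟙                             ≈⟨ ⊛-identityˡ 𝟙 ⟨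
  𝟙 ⊛ 𝟙                         ≲⟨ ⊛-mono-≼ (𝟙≼geometric a) (𝟙≼geometricProduct (suc a) k) ⟩
  geometricProduct a (suc k)    ∎
  where open ≼-Reasoning

-- The quotient of the two products has natural coefficients and constant term 1.
distinctProduct≼oddProduct : ∀ L → distinctProduct L ≼ oddProduct L
distinctProduct≼oddProduct L = begin
  distinctProduct L                             ≈⟨ ⊛-identityʳ (distinctProduct L) ⟨
  distinctProduct L ⊛ 𝟙                         ≲⟨ ⊛-mono-≼ (≼-refl {distinctProduct L}) (𝟙≼geometricProduct L L) ⟩
  distinctProduct L ⊛ geometricProduct L L      ≈⟨ distinctProduct⊛geometricProduct L ⟩
  oddProduct L                                  ∎
  where open ≼-Reasoning

-- The product contains the factor 1 / (1 - q), which absorbs `q`; the other factors preserve the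
-- inequality.
q⊛oddProduct≼ : ∀ L → q ⊛ oddProduct (suc L) ≼ oddProduct (suc L)
q⊛oddProduct≼ zero    = begin
  q ⊛ (g ⊛ 𝟙)              ≲⟨ (λ n → m≤n+m _ (𝟙 n)) ⟩
  𝟙 ⊕ q ⊛ (g ⊛ 𝟙)
    ≈⟨ solve 2 (λ q g → con 1 :+ q :* (g :* con 1) := con 1 :+ (q :* con 1) :* (g :* con 1)) ≗-refl q g ⟩
  𝟙 ⊕ (q ^ 1) ⊛ (g ⊛ 𝟙)    ≈⟨ geometric⊛-unfold 0 𝟙 ⟨
  g ⊛ 𝟙                    ∎
  where
  open ≼-Reasoning
  g = geometric 0
q⊛oddProduct≼ (suc L) = begin
  q ⊛ (g ⊛ O)              ≈⟨ solve 3 (λ q g o → q :* (g :* o) := g :* (q :* o)) ≗-refl q g O ⟩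
  g ⊛ (q ⊛ O)              ≲⟨ ⊛-mono-≼ (≼-refl {g}) (q⊛oddProduct≼ L) ⟩
  g ⊛ O                    ∎
  where
  open ≼-Reasoning
  g = geometric (suc L + suc L)
  O = oddProduct (suc L)

distinctProduct-mono : ∀ m L → distinctProduct L ≼ distinctProduct (m + L)
distinctProduct-mono zero    L = ≼-refl
distinctProduct-mono (suc m) L = begin
  distinctProduct L                              ≲⟨ distinctProduct-mono m L ⟩
  D                                              ≲⟨ f≼f⊕g (x ⊛ D) ⟩
  D ⊕ x ⊛ D
    ≈⟨ solve 2 (λ x D → D :+ x :* D := (con 1 :+ x) :* D) ≗-refl x D ⟩
  (𝟙 ⊕ x) ⊛ D                                    ∎
  where
  open ≼-Reasoning
  x = q ^ suc (m + L)
  D = distinctProduct (m + L)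

elementary-mono : ∀ k m N → elementary k N ≼ elementary k (m + N)
elementary-mono k       zero    N = ≼-refl
elementary-mono zero    (suc m) N = ≼-refl
elementary-mono (suc k) (suc m) N = begin
  elementary (suc k) N          ≲⟨ elementary-mono (suc k) m N ⟩
  elementary (suc k) (m + N)    ≲⟨ f≼f⊕g ((q ⊛ q) ^ suc (m + N) ⊛ elementary k (m + N)) ⟩
  elementary (suc k) (suc m + N) ∎
  where open ≼-Reasoning

-- Below 2k the moment vanishes. For L = 2k + M the closed form has the arguments M and k + M, and
-- each of its factors grows when the argument is raised to `L`.
distinctMoment-≼ : ∀ k L → distinctMoment k L ≼ oddProduct L ⊛ elementary k L
distinctMoment-≼ k L with L <? k + k
... | yes L<2k = λ n → ≤-trans (≤-reflexive (distinctMoment-zero k L L<2k n)) z≤n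
... | no  L≮2k with m≤n⇒∃[o]m+o≡n (≮⇒≥ L≮2k)
... | M , refl = begin
  distinctMoment k (k + k + M)
    ≡⟨ cong (distinctMoment k) (+-assoc k k M) ⟩
  distinctMoment k (k + (k + M))
    ≈⟨ distinctMoment-closed k M ⟩
  distinctProduct M ⊛ elementary k (k + M)
    ≲⟨ ⊛-mono-≼ (distinctProduct-mono (k + k) M) (elementary-mono k k (k + M)) ⟩
  distinctProduct (k + k + M) ⊛ elementary k (k + (k + M))
    ≡⟨ cong (λ N → distinctProduct (k + k + M) ⊛ elementary k N) (+-assoc k k M) ⟨
  distinctProduct (k + k + M) ⊛ elementary k (k + k + M)
    ≲⟨ ⊛-mono-≼ (distinctProduct≼oddProduct (k + k + M)) (≼-refl {elementary k (k + k + M)}) ⟩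
  oddProduct (k + k + M) ⊛ elementary k (k + k + M) ∎
  where open ≼-Reasoning

-- Lower bounds for the hook moments of odd parts

largestOdd : ∀ L → 2 * suc L ∸ 1 ≡ suc (L + L)
largestOdd L = trans (+-suc L (L + 0)) (cong (λ m → suc (L + m)) (+-identityʳ L))

odd-1+2L : ∀ L → Odd (suc (L + L))
odd-1+2L L 2∣ with () ← ∣1⇒≡1 (∣m+n∣m⇒∣n {m = L + L} (subst (2 ∣_) (+-comm 1 (L + L)) 2∣)
  (subst (λ m → 2 ∣ L + m) (+-identityʳ L) (m∣m*n L)))

oddUpTo-bound : ∀ {L xs} → OddUpTo (suc L) xs → All (_≤ suc (L + L)) xs
oddUpTo-bound {L} {xs} (_ , xs≤) = subst (λ b → All (_≤ b) xs) (largestOdd L) xs≤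

-- The next odd part exceeds the old bound; at `L` equal to 0, truncated subtraction makes that
-- bound 0.
bound< : ∀ L → 2 * L ∸ 1 < suc (L + L)
bound< L = s≤s (≤-trans (m∸n≤m (2 * L) 1) (≤-reflexive (cong (L +_) (+-identityʳ L))))

-- Repetitions are allowed, so after one part 2L + 1 is removed the rest still ranges over the
-- larger family; hence the same family occurs on both sides.
oddUpTo-step : ∀ L (f : List ℕ → ℕ) →
  weight f (partitionsWith (oddUpTo? L)) ⊕
  (q ^ suc (L + L)) ⊛ weight (f ∘ (suc (L + L) ∷_)) (partitionsWith (oddUpTo? (suc L))) ≼
  weight f (partitionsWith (oddUpTo? (suc L)))
oddUpTo-step L f = weight-≽-split (oddUpTo? (suc L)) (oddUpTo? L) (oddUpTo? (suc L)) (suc (L + L)) f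
  (s≤s z≤n)
  (λ (odd , xs≤) → odd , All.map (λ x≤ → ≤-trans x≤ (∸-monoˡ-≤ 1 (*-monoʳ-≤ 2 (n≤1+n L)))) xs≤)
  (λ (_ , s∷ys≤) → <⇒≱ (bound< L) (All.head s∷ys≤))
  (λ (odd , ys≤) → oddUpTo-bound (odd , ys≤) , odd-1+2L L ∷ odd , ≤-reflexive (sym (largestOdd L)) ∷ ys≤)

-- Prepending 2L + 3 never destroys a hook, and it creates one when the other parts are at most 2L +
-- 1, since the gap is then at least two. Pascal's rule gives the extra moment.
oddUpTo-gap : ∀ k L →
  hookMoment (oddUpTo? (2 + L)) (suc k) ⊕ hookMoment (oddUpTo? (suc L)) k ≼
  weight (λ xs → hooksOfLength 2 (suc (suc L + suc L) ∷ xs) C suc k) (partitionsWith (oddUpTo? (2 + L)))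
oddUpTo-gap k L n = ≤-trans
  (+-monoʳ-≤ (hookMoment (oddUpTo? (2 + L)) (suc k) n)
    (sum-map-⊆ _ (partitionsWith-unique (oddUpTo? (suc L)) n) sub))
  (sum-map-≥-split small? _ (λ xs → hooksOfLength 2 xs C suc k) (λ xs → hooksOfLength 2 xs C k)
    (All.tabulate {xs = partitionsWith (oddUpTo? (2 + L)) n} λ {xs} _ →
      (λ xs≤ → ≤-reflexive (trans (sym ([1+n]C[1+k] (hooksOfLength 2 xs) k))
        (cong (_C suc k) (trans (sym (hooks₂-gap xs≤)) (cong (λ s → hooksOfLength 2 (s ∷ xs)) (sym s≡))))))
      , C-monoˡ-≤ (suc k) (hooksOfLength-mono-∷ 2 (suc (suc L + suc L)) xs)))
  where
  s≡ : suc (suc L + suc L) ≡ 2 + suc (L + L)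
  s≡ = cong (2 +_) (+-suc L L)
  small? : Decidable (All (_≤ suc (L + L)))
  small? = All.all? (_≤? suc (L + L))
  sub : partitionsWith (oddUpTo? (suc L)) n ⊆ filter small? (partitionsWith (oddUpTo? (2 + L)) n)
  sub xs∈ with π , odd , xs≤ ← ∈-partitionsWith⁻ (oddUpTo? (suc L)) {n} xs∈ =
    ∈-filter⁺ small? (∈-partitionsWith⁺ (oddUpTo? (2 + L)) π
      (odd , All.map (λ x≤ → ≤-trans x≤ (∸-monoˡ-≤ 1 (*-monoʳ-≤ 2 (n≤1+n (suc L))))) xs≤))
      (oddUpTo-bound (odd , xs≤))

-- In a column of at least two ones, the last cell but one has hook length two; further ones on top
-- keep it.
hooks₂-ones : ∀ {xs} → OddUpTo 1 xs → 1 ≤ hooksOfLength 2 (1 ∷ 1 ∷ xs)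
hooks₂-ones {[]}         _ = ≤-refl
hooks₂-ones {0 ∷ xs}     (odd0 ∷ _ , _) = contradiction (2 ∣0) odd0
hooks₂-ones {1 ∷ xs}     (_ ∷ odd , _ ∷ xs≤) =
  ≤-trans (hooks₂-ones (odd , xs≤)) (hooksOfLength-mono-∷ 2 1 (1 ∷ 1 ∷ xs))
hooks₂-ones {suc (suc x) ∷ xs} (_ , s≤s () ∷ _)

-- Replaces the gap argument for parts of size 1, whose rows are too short for it: two prepended
-- ones, of weight q², guarantee a hook.
oddUpTo-one : q ⊛ (q ⊛ hookMoment (oddUpTo? 1) 0) ≼ hookMoment (oddUpTo? 1) 1
oddUpTo-one = begin
  q ⊛ (q ⊛ hookMoment (oddUpTo? 1) 0)
    ≲⟨ ⊛-mono-≼ (≼-refl {q}) (⊛-mono-≼ (≼-refl {q}) two) ⟩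
  q ⊛ (q ⊛ weight (h₁ ∘ (1 ∷_) ∘ (1 ∷_)) odds)
    ≲⟨ ⊛-mono-≼ (≼-refl {q}) (q⊛weight≼ (h₁ ∘ (1 ∷_))) ⟩
  q ⊛ weight (h₁ ∘ (1 ∷_)) odds
    ≲⟨ q⊛weight≼ h₁ ⟩
  hookMoment (oddUpTo? 1) 1 ∎
  where
  open ≼-Reasoning
  odds : ℕ → List (List ℕ)
  odds = partitionsWith (oddUpTo? 1)
  h₁ : List ℕ → ℕ
  h₁ xs = hooksOfLength 2 xs C 1
  two : hookMoment (oddUpTo? 1) 0 ≼ weight (h₁ ∘ (1 ∷_) ∘ (1 ∷_)) odds
  two n = sum-map-mono-≤ (All.tabulate λ {xs} xs∈ →
    C-monoˡ-≤ 1 {1} (hooks₂-ones (proj₂ (∈-partitionsWith⁻ (oddUpTo? 1) {n} xs∈))))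
  q⊛weight≼ : ∀ f → q ⊛ weight (f ∘ (1 ∷_)) odds ≼ weight f odds
  q⊛weight≼ f = begin
    q ⊛ w                  ≈⟨ ⊛-congʳ {w} (⊛-identityʳ q) ⟨
    (q ^ 1) ⊛ w            ≲⟨ (λ n → m≤n+m _ (v n)) ⟩
    v ⊕ (q ^ 1) ⊛ w        ≲⟨ oddUpTo-step 0 f ⟩
    weight f odds          ∎
    where
    v = weight f (partitionsWith (oddUpTo? 0))
    w = weight (f ∘ (1 ∷_)) odds

-- Induction on `L`. For positive order the bound 1 is separate, because its hooks come from legs
-- rather than gaps; beyond it, each new part size gives a supersolution of a fixpoint equation.
oddProduct⊛elementary-≼ : ∀ k L → oddProduct L ⊛ elementary k L ≼ hookMoment (oddUpTo? L) k
oddProduct⊛elementary-≼ zero zero = begin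
  𝟙 ⊛ 𝟙    ≈⟨ ⊛-identityˡ 𝟙 ⟩
  𝟙        ≲⟨ (λ { zero → ≤-refl ; (suc n) → z≤n }) ⟩
  hookMoment (oddUpTo? 0) 0 ∎
  where open ≼-Reasoning
oddProduct⊛elementary-≼ (suc k) zero = begin
  𝟙 ⊛ 𝟘    ≈⟨ ⊛-identityˡ 𝟘 ⟩
  𝟘        ≲⟨ (λ _ → z≤n) ⟩
  hookMoment (oddUpTo? 0) (suc k) ∎
  where open ≼-Reasoning
oddProduct⊛elementary-≼ zero (suc L) = begin
  (g ⊛ O) ⊛ 𝟙    ≈⟨ ⊛-assoc g O 𝟙 ⟩
  g ⊛ (O ⊛ 𝟙)    ≲⟨ ⊛-mono-≼ (≼-refl {g}) (oddProduct⊛elementary-≼ zero L) ⟩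
  g ⊛ m          ≲⟨ geometric⊛-≼ (L + L) m (oddUpTo-step L (λ xs → hooksOfLength 2 xs C 0)) ⟩
  hookMoment (oddUpTo? (suc L)) 0 ∎
  where
  open ≼-Reasoning
  g = geometric (L + L)
  O = oddProduct L
  m = hookMoment (oddUpTo? L) 0
oddProduct⊛elementary-≼ (suc zero) (suc zero) = begin
  O ⊛ (𝟘 ⊕ (q ⊛ q) ^ 1 ⊛ 𝟙)
    -- With one variable the polynomial of order 1 is q², the weight of the two ones in
    -- `oddUpTo-one`.
    ≈⟨ solve 2 (λ q O → O :* (con 0 :+ ((q :* q) :* con 1) :* con 1) := q :* (q :* (O :* con 1))) ≗-refl q O ⟩
  q ⊛ (q ⊛ (O ⊛ 𝟙))
    ≲⟨ ⊛-mono-≼ (≼-refl {q}) (⊛-mono-≼ (≼-refl {q}) (oddProduct⊛elementary-≼ zero 1)) ⟩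
  q ⊛ (q ⊛ hookMoment (oddUpTo? 1) 0)
    ≲⟨ oddUpTo-one ⟩
  hookMoment (oddUpTo? 1) 1 ∎
  where
  open ≼-Reasoning
  O = oddProduct 1
oddProduct⊛elementary-≼ (suc (suc k)) (suc zero) = begin
  O ⊛ (𝟘 ⊕ y ⊛ 𝟘)
    ≈⟨ solve 2 (λ y O → O :* (con 0 :+ y :* con 0) := con 0) ≗-refl y O ⟩
  𝟘
    ≲⟨ (λ _ → z≤n) ⟩
  hookMoment (oddUpTo? 1) (2 + k) ∎
  where
  open ≼-Reasoning
  O = oddProduct 1
  y = (q ⊛ q) ^ 1
oddProduct⊛elementary-≼ (suc k) (suc (suc M)) = begin
  (g ⊛ O) ⊛ (E ⊕ (q ⊛ q) ^ suc L ⊛ F)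
    ≈⟨ ⊛-congˡ {g ⊛ O} (⊕-congˡ {E} (⊛-congʳ {F} y≗)) ⟩
  (g ⊛ O) ⊛ (E ⊕ (q ⊛ x) ⊛ F)
    -- The new variable is q²ᴸ⁺², but the new part weighs only q²ᴸ⁺¹. The surplus factor `q` is
    -- moved next to `O`, which absorbs it.
    ≈⟨ solve 6 (λ g O E q x F → (g :* O) :* (E :+ (q :* x) :* F) :=
         g :* (O :* E :+ x :* ((q :* O) :* F))) ≗-refl g O E q x F ⟩
  g ⊛ (O ⊛ E ⊕ x ⊛ ((q ⊛ O) ⊛ F))
    ≲⟨ ⊛-mono-≼ (≼-refl {g}) (⊕-mono-≼ (≼-refl {O ⊛ E})
         (⊛-mono-≼ (≼-refl {x}) (⊛-mono-≼ (q⊛oddProduct≼ M) (≼-refl {F})))) ⟩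
  g ⊛ (O ⊛ E ⊕ x ⊛ (O ⊛ F))
    ≲⟨ ⊛-mono-≼ (≼-refl {g}) (⊕-mono-≼ (oddProduct⊛elementary-≼ (suc k) (suc M))
         (⊛-mono-≼ (≼-refl {x}) (oddProduct⊛elementary-≼ k (suc M)))) ⟩
  g ⊛ (m ⊕ x ⊛ m₀)
    -- By `grow`, `m′` is a supersolution of X = (m + x m₀) + x X.
    ≲⟨ geometric⊛-≼ (L + L) (m ⊕ x ⊛ m₀) grow ⟩
  m′ ∎
  where
  open ≼-Reasoning
  L = suc M
  g = geometric (L + L)
  O = oddProduct L
  E = elementary (suc k) L
  F = elementary k L
  x = q ^ suc (L + L)
  m = hookMoment (oddUpTo? L) (suc k)
  m₀ = hookMoment (oddUpTo? L) k
  m′ = hookMoment (oddUpTo? (suc L)) (suc k)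
  y≗ : (q ⊛ q) ^ suc L ≗ q ⊛ x
  y≗ n = trans ([x⊛x]^n≗x^[n+n] q (suc L) n) (cong (λ e → (q ^ suc e) n) (+-suc L L))
  grow : (m ⊕ x ⊛ m₀) ⊕ x ⊛ m′ ≼ m′
  grow = begin
    (m ⊕ x ⊛ m₀) ⊕ x ⊛ m′
      ≈⟨ solve 4 (λ m x m₀ m′ → (m :+ x :* m₀) :+ x :* m′ := m :+ x :* (m′ :+ m₀)) ≗-refl m x m₀ m′ ⟩
    m ⊕ x ⊛ (m′ ⊕ m₀)
      ≲⟨ ⊕-mono-≼ (≼-refl {m}) (⊛-mono-≼ (≼-refl {x}) (oddUpTo-gap k M)) ⟩
    m ⊕ x ⊛ weight (λ xs → hooksOfLength 2 (suc (L + L) ∷ xs) C suc k) (partitionsWith (oddUpTo? (suc L)))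
      ≲⟨ oddUpTo-step L (λ xs → hooksOfLength 2 xs C suc k) ⟩
    m′ ∎

-- From moment series back to `a₂` and `b₂`

hooks₂≤ : ∀ n → All (λ xs → hooksOfLength 2 xs ≤ n) (partitions n)
hooks₂≤ n = All.tabulate λ {xs} xs∈ →
  subst (hooksOfLength 2 xs ≤_) (size (Equivalence.to (∈-partitions n xs) xs∈)) (hooksOfLength-≤ 2 xs)

∑-a₂ : ∀ k L n → (∑[ m ≤ n ] (m C k) * a₂ L m n) ≡ hookMoment (oddUpTo? L) k n
∑-a₂ k L n = ∑-by-value (oddUpTo? L) (oddCondition? L) (_C k) (hooksOfLength 2)
  (mk⇔ (λ (odd , xs≤ , eq) → (odd , xs≤) , eq) (λ ((odd , xs≤) , eq) → odd , xs≤ , eq))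
  n (partitions n) (hooks₂≤ n)

∑-b₂ : ∀ k L n → (∑[ m ≤ n ] (m C k) * b₂ L m n) ≡ hookMoment (distinctUpTo? L) k n
∑-b₂ k L n = ∑-by-value (distinctUpTo? L) (distinctCondition? L) (_C k) (hooksOfLength 2)
  (mk⇔ (λ (uniq , xs≤ , eq) → (uniq , xs≤) , eq) (λ ((uniq , xs≤) , eq) → uniq , xs≤ , eq))
  n (partitions n) (hooks₂≤ n)

corollary1p6 : (L n : ℕ) → L ≥ 1 →
    (∑[ m ≤ n ] (m C 2) * a₂ L m n) ≥ (∑[ m ≤ n ] (m C 2) * b₂ L m n)
corollary1p6 L n _ = begin
  (∑[ m ≤ n ] (m C 2) * b₂ L m n)      ≡⟨ ∑-b₂ 2 L n ⟩
  hookMoment (distinctUpTo? L) 2 n     ≤⟨ hookMoment-distinct-≼ 2 L n ⟩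
  distinctMoment 2 L n                 ≤⟨ distinctMoment-≼ 2 L n ⟩
  (oddProduct L ⊛ elementary 2 L) n    ≤⟨ oddProduct⊛elementary-≼ 2 L n ⟩
  hookMoment (oddUpTo? L) 2 n          ≡⟨ ∑-a₂ 2 L n ⟨
  (∑[ m ≤ n ] (m C 2) * a₂ L m n)      ∎
  where open ≤-Reasoning
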